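{- Let $\ell\in\mathbb N$ and $q\in\mathbb N$ be (positive integer) constants and let $\beta:=2^{1-q}$. For an instance of UFPP and each integer $k$, let $F^{k,\ell}:=\{i\in T\mid 2^k\le b(i)<2^{k+\ell}\}$. Assume we are given an $(\alpha,\beta)$-approximation algorithm for each set $F^{k,\ell}$ with running time $O(p(n))$ for a polynomial $p$. Then there is a $\left(\frac{\ell+q}{\ell}\cdot\alpha\right)$-approximation algorithm with running time $O(m\cdot p(n))$ for the set of all tasks.
   Context: UFPP (Unsplittable Flow Problem on a Path): an instance consists of a path $P=(V,E)$ with $V=\{0,\ldots,m\}$, $E=\{\{i,i+1\}\mid 0\le i\le m-1\}$, a positive integer capacity $u_e$ for each edge $e\in E$, and a set $T=\{1,\ldots,n\}$ of tasks, where task $i$ has a start vertex $s_i\in V$ and end vertex $t_i\in V$ with $s_i<t_i$, a positive integer demand $d_i$, and a positive integer profit $w_i$. Task $i$ uses edge $e$ if $e$ lies on the subpath from $s_i$ to $t_i$; $T_e$ is the set of tasks using $e$. A set $F\subseteq T$ is feasible if $\sum_{i\in F\cap T_e}d_i\le u_e$ for every $e\in E$. The goal is to find a feasible $F$ maximizing the profit $w(F)=\sum_{i\in F}w_i$. The bottleneck capacity $b(i)$ is the minimum of $u_e$ over all edges $e$ used by $i$. For $F\subseteq T$, $OPT(F)$ denotes an optimal solution of the instance restricted to the task set $F$. Let $\alpha>0$, $\beta\ge0$. A set $F\subseteq F^{k,\ell}$ is $(\alpha,\beta)$-approximative if $w(F)\ge\frac1\alpha\cdot w(OPT(F^{k,\ell}))$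 and $\sum_{i\in F\cap T_e}d_i\le u_e-\beta\cdot2^k$ for each edge $e$ with $T_e\cap F^{k,\ell}\neq\emptyset$. An algorithm that computes $(\alpha,\beta)$-approximative sets in polynomial time is called an $(\alpha,\beta)$-approximation algorithm. An $\alpha$-approximation algorithm is a polynomial time algorithm that computes a feasible solution whose profit is at least $\frac1\alpha$ times the optimal profit. -}

module Defs where

open import Data.Bool using (Bool; true; false; if_then_else_)
open import Data.Fin using (Fin; toℕ; fromℕ<)
open import Data.Fin.Properties using (toℕ≤pred[n])
open import Data.Fin.Subset using (Subset; _⊆_; _∩_; ⊤; Nonempty)
open import Data.Integer as ℤ using (ℤ; +_; -[1+_]; +[1+_]; 0ℤ; 1ℤ)
open import Data.List using (List; []; _∷_; _∷ʳ_; allFin; filter; foldr; map)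
import Data.List as List
open import Data.List.Extrema.Nat using (min)
open import Data.Nat as ℕ using (ℕ; suc; NonZero)
open import Data.Nat.Logarithm using (⌊log₂_⌋)
import Data.Nat.Properties as ℕₚ
open import Data.Product using (Σ; ∃; ∃-syntax; _×_; _,_)
open import Data.Rational as ℚ using (ℚ; 0ℚ; Positive; 1/_)
import Data.Rational.Properties as ℚₚ
open import Data.Sum using (_⊎_)
open import Data.Vec using (lookup; tabulate; toList)
open import Relation.Binary.PropositionalEquality
open import Relation.Nullary using (Dec; yes; no; does; ¬_)
open import Relation.Nullary.Decidable using (_×-dec_)
open import Algebra.Properties.CommutativeMonoid.Sum ℕₚ.+-0-commutativeMonoid
  using (sum)

------------------------------------------------------------------------
-- Numbers

fromℕ : ℕ → ℚ
fromℕ a = + a ℚ./ 1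

2^_ : ℤ → ℚ
2^ (+ a)    = fromℕ (2 ℕ.^ a)
2^ -[1+ a ] = (1ℤ ℚ./ (2 ℕ.^ suc a)) {{ℕₚ.m^n≢0 2 (suc a)}}

-- Two-sided Dedekind cuts: L p means p < x, and U p means x < p.
record ℝ : Set₁ where
  field
    L U       : ℚ → Set
    inhabited : ∃ L × ∃ U
    L-down    : ∀ {p r} → p ℚ.< r → L r → L p
    U-up      : ∀ {p r} → p ℚ.< r → U p → U r
    L-round   : ∀ {p} → L p → ∃[ r ] p ℚ.< r × L r
    U-round   : ∀ {r} → U r → ∃[ p ] p ℚ.< r × U p
    disjoint  : ∀ {p} → ¬ (L p × U p)
    located   : ∀ {p r} → p ℚ.< r → L p ⊎ U r

Positiveᴿ : ℝ → Set
Positiveᴿ x = ℝ.L x 0ℚ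

-- c · x, for which p < c · x iff p / c < x.
module _ (c : ℚ) .{{c>0 : Positive c}} where

  private
    instance
      c≢0 = ℚₚ.pos⇒nonZero c
      c⁻¹>0 = ℚₚ.1/pos⇒pos c

    c⁻¹ : ℚ
    c⁻¹ = 1/ c

    shrink : ∀ {p r} → p ℚ.< r → c⁻¹ ℚ.* p ℚ.< c⁻¹ ℚ.* r
    shrink = ℚₚ.*-monoʳ-<-pos c⁻¹

    c⁻¹[cp]≡p : ∀ p → c⁻¹ ℚ.* (c ℚ.* p) ≡ p
    c⁻¹[cp]≡p p = trans (sym (ℚₚ.*-assoc c⁻¹ c p))
      (trans (cong (ℚ._* p) (ℚₚ.*-inverseˡ c)) (ℚₚ.*-identityˡ p))

    c[c⁻¹p]≡p : ∀ p → c ℚ.* (c⁻¹ ℚ.* p) ≡ p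
    c[c⁻¹p]≡p p = trans (sym (ℚₚ.*-assoc c c⁻¹ p))
      (trans (cong (ℚ._* p) (ℚₚ.*-inverseʳ c)) (ℚₚ.*-identityˡ p))

    grow : ∀ {p r} → p ℚ.< r → c ℚ.* p ℚ.< c ℚ.* r
    grow = ℚₚ.*-monoʳ-<-pos c

  infixl 7 _·_
  _·_ : ℝ → ℝ
  _·_ x = record
    { L         = λ p → x.L (c⁻¹ ℚ.* p)
    ; U         = λ p → x.U (c⁻¹ ℚ.* p)
    ; inhabited =
        let ((p , Lp) , (r , Ur)) = x.inhabited
        in  (c ℚ.* p , subst x.L (sym (c⁻¹[cp]≡p p)) Lp)
          , (c ℚ.* r , subst x.U (sym (c⁻¹[cp]≡p r)) Ur)
    ; L-down    = λ p<r → x.L-down (shrink p<r)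
    ; U-up      = λ p<r → x.U-up (shrink p<r)
    ; L-round   = λ {p} Lp →
        let (r , p<r , Lr) = x.L-round Lp
        in  c ℚ.* r
          , subst (ℚ._< c ℚ.* r) (c[c⁻¹p]≡p p) (grow p<r)
          , subst x.L (sym (c⁻¹[cp]≡p r)) Lr
    ; U-round   = λ {r} Ur →
        let (p , p<r , Up) = x.U-round Ur
        in  c ℚ.* p
          , subst (c ℚ.* p ℚ.<_) (c[c⁻¹p]≡p r) (grow p<r)
          , subst x.U (sym (c⁻¹[cp]≡p p)) Up
    ; disjoint  = x.disjoint
    ; located   = λ p<r → x.located (shrink p<r)
    }
    where module x = ℝ x

-- b ≥ (1/α) · a for α > 0, i.e. a ≤ α · b; since b ≥ 0, the number α · b
-- is the infimum of the r · b over rational r > α.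
_≥[1/_]·_ : ℕ → ℝ → ℕ → Set
b ≥[1/ α ]· a = ∀ r → ℝ.U α r → fromℕ a ℚ.≤ r ℚ.* fromℕ b

_/ᶜ_ : ∀ a b .{{_ : NonZero a}} .{{_ : NonZero b}} → Σ ℚ Positive
a /ᶜ b = + a ℚ./ b , ℚₚ.normalize-pos a b

-- (ℓ + q) / ℓ · α
scaled : ∀ (ℓ q : ℕ) .{{_ : NonZero ℓ}} → ℝ → ℝ
scaled ℓ@(suc _) q α = let (c , c>0) = (ℓ ℕ.+ q) /ᶜ ℓ in _·_ c {{c>0}} α

------------------------------------------------------------------------
-- Unsplittable flow on a path

-- Vertices are Fin (suc m); edge e : Fin m joins the vertices e and e + 1.
record Instance : Set where
  field
    n m : ℕ
    u   : Fin m → ℕ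
    s t : Fin n → Fin (suc m)
    d w : Fin n → ℕ
    u>0 : ∀ e → 0 ℕ.< u e
    s<t : ∀ i → toℕ (s i) ℕ.< toℕ (t i)
    d>0 : ∀ i → 0 ℕ.< d i
    w>0 : ∀ i → 0 ℕ.< w i

⟪_⟫ : ∀ {n} {P : Fin n → Set} → (∀ i → Dec (P i)) → Subset n
⟪ P? ⟫ = tabulate (λ i → does (P? i))

∑ : ∀ {n} → Subset n → (Fin n → ℕ) → ℕ
∑ F f = sum (λ i → if lookup F i then f i else 0)

module _ (I : Instance) where
  open Instance I

  Uses : Fin n → Fin m → Set
  Uses i e = toℕ (s i) ℕ.≤ toℕ e × toℕ e ℕ.< toℕ (t i)

  uses? : ∀ i e → Dec (Uses i e)
  uses? i e = (toℕ (s i) ℕ.≤? toℕ e) ×-dec (toℕ e ℕ.<? toℕ (t i))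

  T[_] : Fin m → Subset n
  T[ e ] = ⟪ (λ i → uses? i e) ⟫

  load : Subset n → Fin m → ℕ
  load F e = ∑ (F ∩ T[ e ]) d

  profit : Subset n → ℕ
  profit F = ∑ F w

  Feasible : Subset n → Set
  Feasible F = ∀ e → load F e ℕ.≤ u e

  IsOPT : Subset n → Subset n → Set
  IsOPT R O = O ⊆ R × Feasible O ×
    (∀ G → G ⊆ R → Feasible G → profit G ℕ.≤ profit O)

  firstEdge : Fin n → Fin m
  firstEdge i = fromℕ< (ℕₚ.<-≤-trans (s<t i) (toℕ≤pred[n] (t i)))

  -- `min` takes a default value besides the list; the first edge of the
  -- subpath is itself in the list, so the default has no effect.
  bottleneck : Fin n → ℕ
  bottleneck i =
    min (u (firstEdge i)) (map u (filter (uses? i) (allFin m)))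

  group : ℤ → ℕ → Subset n
  group k ℓ = ⟪ (λ i →
    (2^ k ℚ.≤? fromℕ (bottleneck i)) ×-dec
    (fromℕ (bottleneck i) ℚ.<? 2^ (k ℤ.+ + ℓ))) ⟫

  Approximative : ℝ → ℚ → ℤ → ℕ → Subset n → Set
  Approximative α β k ℓ F =
    F ⊆ group k ℓ ×
    (∀ O → IsOPT (group k ℓ) O → profit F ≥[1/ α ]· profit O) ×
    (∀ e → Nonempty (T[ e ] ∩ group k ℓ) →
      fromℕ (load F e) ℚ.≤ fromℕ (u e) ℚ.- β ℚ.* 2^ k)

  ApproxSolution : ℝ → Subset n → Set
  ApproxSolution α F =
    Feasible F × (∀ O → IsOPT ⊤ O → profit F ≥[1/ α ]· profit O)

------------------------------------------------------------------------
-- Random access machine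
--
-- Integer registers and integer arrays with indirect addressing, unit cost
-- per operation, structured control flow and non-recursive procedures.  The
-- instance is read-only random access input and the answer is written to an
-- output tape.  The fixed operations (addition, subtraction, quotient,
-- remainder, ⌊log₂⌋) lengthen numbers by at most one bit per step, so unit
-- cost cannot hide exponentially long computations.  Further unit-cost binary
-- operations, such as multiplication, are a parameter of the machine.

record Extension : Set₁ where
  field
    Op  : Set
    ⟦_⟧ : Op → ℤ → ℤ → ℤ

data Expr (X : Extension) : Set where
  lit                 : ℤ → Expr X
  reg                 : ℕ → Expr X
  arr                 : ℕ → Expr X → Expr X
  #tasks #edges       : Expr X
  capacity            : Expr X → Expr X
  start end           : Expr X → Expr X
  demand weight       : Expr X → Expr X
  _⊕_ _⊖_ _⊘_ _mod_   : Expr X → Expr X → Expr X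
  log₂                : Expr X → Expr X
  op                  : Extension.Op X → Expr X → Expr X → Expr X

infixl 6 _⊕_ _⊖_
infixl 7 _⊘_ _mod_

-- Tests succeed when the value is positive.  `call a P e` runs P in a fresh
-- memory with e in register 0 and leaves the output of P in array a.
data Com (X : Extension) : Set where
  skip          : Com X
  _≔_           : ℕ → Expr X → Com X
  _[_]≔_        : ℕ → Expr X → Expr X → Com X
  emit          : Expr X → Com X
  _⨾_           : Com X → Com X → Com X
  ifpos_then_else_ : Expr X → Com X → Com X → Com X
  whilepos_loop_  : Expr X → Com X → Com X
  call          : ℕ → Com X → Expr X → Com X

infix  5 _≔_ _[_]≔_
infix  4 ifpos_then_else_ whilepos_loop_
infixr 3 _⨾_

record State : Set where
  constructor state
  field
    regs : ℕ → ℤ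
    arrs : ℕ → ℤ → ℤ
    out  : List ℤ

open State

initial : ℤ → State
initial k = state (λ { 0 → k ; (suc _) → 0ℤ }) (λ _ _ → 0ℤ) []

-- Out-of-range reads give 0.
read : ∀ {n} → (Fin n → ℤ) → ℤ → ℤ
read {n} f (+ j) with j ℕ.<? n
... | yes j<n = f (fromℕ< j<n)
... | no  _   = 0ℤ
read f -[1+ _ ] = 0ℤ

-- Division by 0 gives 0.
quot rem : ℤ → ℤ → ℤ
quot x (+ 0)        = 0ℤ
quot x y@(+[1+ _ ]) = x ℤ./ y
quot x y@(-[1+ _ ]) = x ℤ./ y
rem x (+ 0)         = 0ℤ
rem x y@(+[1+ _ ])  = + (x ℤ.% y)
rem x y@(-[1+ _ ])  = + (x ℤ.% y)

module _ {X : Extension} where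

  eval : Instance → State → Expr X → ℤ
  eval I σ (lit c)      = c
  eval I σ (reg x)      = regs σ x
  eval I σ (arr a e)    = arrs σ a (eval I σ e)
  eval I σ #tasks       = + Instance.n I
  eval I σ #edges       = + Instance.m I
  eval I σ (capacity e) = read (λ j → + Instance.u I j) (eval I σ e)
  eval I σ (start e)    = read (λ j → + toℕ (Instance.s I j)) (eval I σ e)
  eval I σ (end e)      = read (λ j → + toℕ (Instance.t I j)) (eval I σ e)
  eval I σ (demand e)   = read (λ j → + Instance.d I j) (eval I σ e)
  eval I σ (weight e)   = read (λ j → + Instance.w I j) (eval I σ e)
  eval I σ (e ⊕ f)      = eval I σ e ℤ.+ eval I σ f
  eval I σ (e ⊖ f)      = eval I σ e ℤ.- eval I σ f
  eval I σ (e ⊘ f)      = quot (eval I σ e) (eval I σ f)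
  eval I σ (e mod f)    = rem (eval I σ e) (eval I σ f)
  eval I σ (log₂ e)     = + ⌊log₂ ℤ.∣ eval I σ e ∣ ⌋
  eval I σ (op o e f)   = Extension.⟦_⟧ X o (eval I σ e) (eval I σ f)

  cost : Expr X → ℕ
  cost (lit _)      = 1
  cost (reg _)      = 1
  cost (arr _ e)    = 1 ℕ.+ cost e
  cost #tasks       = 1
  cost #edges       = 1
  cost (capacity e) = 1 ℕ.+ cost e
  cost (start e)    = 1 ℕ.+ cost e
  cost (end e)      = 1 ℕ.+ cost e
  cost (demand e)   = 1 ℕ.+ cost e
  cost (weight e)   = 1 ℕ.+ cost e
  cost (e ⊕ f)      = 1 ℕ.+ cost e ℕ.+ cost f
  cost (e ⊖ f)      = 1 ℕ.+ cost e ℕ.+ cost f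
  cost (e ⊘ f)      = 1 ℕ.+ cost e ℕ.+ cost f
  cost (e mod f)    = 1 ℕ.+ cost e ℕ.+ cost f
  cost (log₂ e)     = 1 ℕ.+ cost e
  cost (op _ e f)   = 1 ℕ.+ cost e ℕ.+ cost f

setReg : ℕ → ℤ → State → State
setReg x v σ = record σ
  { regs = λ y → if does (x ℕ.≟ y) then v else regs σ y }

setArr : ℕ → (ℤ → ℤ) → State → State
setArr a f σ = record σ
  { arrs = λ b → if does (a ℕ.≟ b) then f else arrs σ b }

setCell : ℕ → ℤ → ℤ → State → State
setCell a j v σ = setArr a
  (λ i → if does (j ℤ.≟ i) then v else arrs σ a i) σ

-- I ⊢ P , σ ⇓ τ ⟨ c ⟩: on input I, started in σ, the program P halts in τ
-- after c steps.
infix 4 _⊢_,_⇓_⟨_⟩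
data _⊢_,_⇓_⟨_⟩ {X : Extension} (I : Instance) :
     Com X → State → State → ℕ → Set where
  ⇓skip  : ∀ {σ} → I ⊢ skip , σ ⇓ σ ⟨ 1 ⟩
  ⇓≔     : ∀ {σ x e} →
           I ⊢ x ≔ e , σ ⇓ setReg x (eval I σ e) σ ⟨ 1 ℕ.+ cost e ⟩
  ⇓[]≔   : ∀ {σ a e f} →
           I ⊢ a [ e ]≔ f , σ ⇓ setCell a (eval I σ e) (eval I σ f) σ
             ⟨ 1 ℕ.+ cost e ℕ.+ cost f ⟩
  ⇓emit  : ∀ {σ e} →
           I ⊢ emit e , σ ⇓ record σ { out = out σ ∷ʳ eval I σ e }
             ⟨ 1 ℕ.+ cost e ⟩
  ⇓⨾     : ∀ {σ τ υ P Q c c′} →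
           I ⊢ P , σ ⇓ τ ⟨ c ⟩ → I ⊢ Q , τ ⇓ υ ⟨ c′ ⟩ →
           I ⊢ P ⨾ Q , σ ⇓ υ ⟨ c ℕ.+ c′ ⟩
  ⇓then  : ∀ {σ τ e P Q c} → 0ℤ ℤ.< eval I σ e →
           I ⊢ P , σ ⇓ τ ⟨ c ⟩ →
           I ⊢ ifpos e then P else Q , σ ⇓ τ ⟨ 1 ℕ.+ cost e ℕ.+ c ⟩
  ⇓else  : ∀ {σ τ e P Q c} → eval I σ e ℤ.≤ 0ℤ →
           I ⊢ Q , σ ⇓ τ ⟨ c ⟩ →
           I ⊢ ifpos e then P else Q , σ ⇓ τ ⟨ 1 ℕ.+ cost e ℕ.+ c ⟩
  ⇓done  : ∀ {σ e P} → eval I σ e ℤ.≤ 0ℤ →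
           I ⊢ whilepos e loop P , σ ⇓ σ ⟨ 1 ℕ.+ cost e ⟩
  ⇓loop  : ∀ {σ τ υ e P c c′} → 0ℤ ℤ.< eval I σ e →
           I ⊢ P , σ ⇓ τ ⟨ c ⟩ → I ⊢ whilepos e loop P , τ ⇓ υ ⟨ c′ ⟩ →
           I ⊢ whilepos e loop P , σ ⇓ υ ⟨ 1 ℕ.+ cost e ℕ.+ c ℕ.+ c′ ⟩
  ⇓call  : ∀ {σ τ a P e c} →
           I ⊢ P , initial (eval I σ e) ⇓ τ ⟨ c ⟩ →
           I ⊢ call a P e , σ ⇓ setArr a (read (List.lookup (out τ))) σ
             ⟨ 1 ℕ.+ cost e ℕ.+ c ⟩

-- A set of tasks is written as its 0/1 characteristic vector.
encode : ∀ {n} → Subset n → List ℤ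
encode F = map (λ b → if b then 1ℤ else 0ℤ) (toList F)

Outputs : ∀ {X} → Com X → (I : Instance) → ℤ → Subset (Instance.n I) → ℕ → Set
Outputs P I k F c = ∃[ τ ] (I ⊢ P , initial k ⇓ τ ⟨ c ⟩) × out τ ≡ encode F

------------------------------------------------------------------------
-- Approximation algorithms

-- c₀ + c₁ x + c₂ x² + ⋯
poly : List ℕ → ℕ → ℕ
poly cs x = foldr (λ c r → c ℕ.+ x ℕ.* r) 0 cs

-- Both notions speak about a family 𝓘 of instances.  A running time is
-- O(f) when it is at most C · f for all instances with at least N tasks.

GroupApproxAlg : ∀ {X} → (Instance → Set) → ℝ → ℚ → ℕ → (Instance → ℕ) →
                 Com X → Set
GroupApproxAlg 𝓘 α β ℓ time A =
  ∃[ C ] ∃[ N ] ∀ I → 𝓘 I → ∀ k → ∃[ F ] ∃[ c ]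
    Outputs A I k F c ×
    Approximative I α β k ℓ F ×
    (N ℕ.≤ Instance.n I → c ℕ.≤ C ℕ.* time I)

ApproxAlg : ∀ {X} → (Instance → Set) → ℝ → (Instance → ℕ) → Com X → Set
ApproxAlg 𝓘 α time A =
  ∃[ C ] ∃[ N ] ∀ I → 𝓘 I → ∃[ F ] ∃[ c ]
    Outputs A I 0ℤ F c ×
    ApproxSolution I α F ×
    (N ℕ.≤ Instance.n I → c ℕ.≤ C ℕ.* time I)

-- Let L = ℓ + q.  For each residue c modulo L take the union S_c of the given
-- sets F_k with k ≡ − c.  The tasks of F_k that use an edge e all use one of
-- two edges of capacity below 2^(k+ℓ), the nearest bottleneck edges on either
-- side of e, so F_k puts a load of at most 2 (2^(k+ℓ) − β 2^k) on e.  By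
-- induction all groups of the class below k together put at most β 2^k on e,
-- which is the slack that F_k leaves; hence S_c is feasible.  Every task lies
-- in groups of exactly ℓ of the L classes, so the optimum restricted to the
-- classes has total profit ℓ w(OPT), and the best S_c has profit at least
-- ℓ / (α L) w(OPT).  Each edge is the bottleneck edge of tasks in at most one
-- group per class, so m calls per class suffice; the given algorithm writes n
-- symbols, so the O(n) work around a call is absorbed in its running time.

module Submission where

open import Data.Bool using (Bool; true; false; if_then_else_; _∧_; _∨_)
open import Data.Fin as Fin using (Fin; toℕ; fromℕ<)
import Data.Fin.Properties as Finₚ
open import Data.Fin.Subset using (Subset; _⊆_; _∩_; _∪_; ⊥; ⊤; _∈_; _∉_; Nonempty)
open import Data.Fin.Subset.Properties using (∉⊥; ⊥⊆; ⊆⊤; p⊆p∪q; q⊆p∪q; p∩q⊆p; p∩q⊆q; x∈p∩q⁺; x∈p∩q⁻; x∈p∪q⁺; x∈p∪q⁻; ∩-distribˡ-∪; ∩-distribʳ-∪; _∈?_; _⊆?_; anySubset?; nonempty?)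
open import Data.Integer as ℤ using (ℤ; +_; -[1+_]; _-_; 0ℤ; 1ℤ)
import Data.Integer.Properties as ℤₚ
import Data.Integer.Tactic.RingSolver as ℤ-Solver
open import Data.List as List using (List; []; _∷_; _∷ʳ_; _++_; allFin; drop; filter; length; map)
import Data.List.Properties as Listₚ
open import Data.List.Extrema.Nat using (argmin-sel)
open import Data.List.Membership.Propositional.Properties using (∈-map⁻; ∈-filter⁻)
open import Data.Nat using (ℕ; zero; suc; NonZero; _+_; _*_; _∸_; _^_; _≤_; _<_; z≤n; s≤s; s≤s⁻¹; >-nonZero; ⌊_/2⌋; ⌈_/2⌉; _%_; _/_; _<?_; _≤?_)
open import Data.Nat.DivMod hiding (_mod_)
open import Data.Nat.Induction using (<-rec)
open import Data.Nat.Logarithm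
open import Data.Nat.Properties
import Data.Nat.Tactic.RingSolver as ℕ-Solver
open import Data.Product using (∃; ∃-syntax; _×_; _,_; proj₁; proj₂)
open import Data.Rational as ℚ using (ℚ; 0ℚ; 1ℚ; Positive; NonNegative; 1/_)
import Data.Rational.Properties as ℚₚ
import Data.Rational.Unnormalised as ℚᵘ
import Data.Rational.Unnormalised.Properties as ℚᵘₚ
open import Data.Sum using (_⊎_; inj₁; inj₂)
open import Data.Vec using (lookup; []; _∷_)
import Data.Vec.Properties as Vecₚ
open import Function using (_∘_; id)
open import Relation.Binary using (tri<; tri≈; tri>)
open import Relation.Binary.PropositionalEquality
open import Relation.Nullary using (Dec; does; yes; no; contradiction)
open import Relation.Nullary.Decidable using (_×-dec_; dec-true; dec-false)
open import Algebra.Properties.CommutativeMonoid.Sum +-0-commutativeMonoid using (sum; sum-cong-≗; ∑-comm; ∑-distrib-+)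
open import Algebra.Properties.Semiring.Sum +-*-semiring using (*-distribʳ-sum)
open import Defs
open State

-- Rational scales and logarithms

toℚᵘ-fromℕ : ∀ a → ℚ.toℚᵘ (fromℕ a) ℚᵘ.≃ ℚᵘ.mkℚᵘ (+ a) 0
toℚᵘ-fromℕ a = ℚₚ.toℚᵘ-fromℚᵘ (ℚᵘ.mkℚᵘ (+ a) 0)

fromℕ-homo-+ : ∀ a b → fromℕ (a + b) ≡ fromℕ a ℚ.+ fromℕ b
fromℕ-homo-+ a b = ℚₚ.toℚᵘ-injective (begin
  ℚ.toℚᵘ (fromℕ (a + b))                         ≈⟨ toℚᵘ-fromℕ (a + b) ⟩
  ℚᵘ.mkℚᵘ (+ (a + b)) 0                          ≈⟨ ℚᵘ.*≡* (cong (ℤ._* + 1) (cong₂ ℤ._+_ (ℤₚ.*-identityʳ (+ a)) (ℤₚ.*-identityʳ (+ b)))) ⟨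
  ℚᵘ.mkℚᵘ (+ a) 0 ℚᵘ.+ ℚᵘ.mkℚᵘ (+ b) 0           ≈⟨ ℚᵘₚ.+-cong (toℚᵘ-fromℕ a) (toℚᵘ-fromℕ b) ⟨
  ℚ.toℚᵘ (fromℕ a) ℚᵘ.+ ℚ.toℚᵘ (fromℕ b)         ≈⟨ ℚₚ.toℚᵘ-homo-+ (fromℕ a) (fromℕ b) ⟨
  ℚ.toℚᵘ (fromℕ a ℚ.+ fromℕ b)                   ∎)
  where open ℚᵘₚ.≃-Reasoning

fromℕ-homo-* : ∀ a b → fromℕ (a * b) ≡ fromℕ a ℚ.* fromℕ b
fromℕ-homo-* a b = ℚₚ.toℚᵘ-injective (begin
  ℚ.toℚᵘ (fromℕ (a * b))                         ≈⟨ toℚᵘ-fromℕ (a * b) ⟩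
  ℚᵘ.mkℚᵘ (+ (a * b)) 0                          ≈⟨ ℚᵘ.*≡* (cong (ℤ._* + 1) (ℤₚ.pos-* a b)) ⟩
  ℚᵘ.mkℚᵘ (+ a) 0 ℚᵘ.* ℚᵘ.mkℚᵘ (+ b) 0           ≈⟨ ℚᵘₚ.*-cong (toℚᵘ-fromℕ a) (toℚᵘ-fromℕ b) ⟨
  ℚ.toℚᵘ (fromℕ a) ℚᵘ.* ℚ.toℚᵘ (fromℕ b)         ≈⟨ ℚₚ.toℚᵘ-homo-* (fromℕ a) (fromℕ b) ⟨
  ℚ.toℚᵘ (fromℕ a ℚ.* fromℕ b)                   ∎)
  where open ℚᵘₚ.≃-Reasoning

fromℕ-mono-≤ : ∀ {a b} → a ≤ b → fromℕ a ℚ.≤ fromℕ b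
fromℕ-mono-≤ {a} {b} a≤b = ℚₚ.toℚᵘ-cancel-≤ (begin
  ℚ.toℚᵘ (fromℕ a) ≃⟨ toℚᵘ-fromℕ a ⟩
  ℚᵘ.mkℚᵘ (+ a) 0  ≤⟨ ℚᵘ.*≤* (ℤₚ.*-monoʳ-≤-nonNeg (+ 1) (ℤ.+≤+ a≤b)) ⟩
  ℚᵘ.mkℚᵘ (+ b) 0  ≃⟨ toℚᵘ-fromℕ b ⟨
  ℚ.toℚᵘ (fromℕ b) ∎)
  where open ℚᵘₚ.≤-Reasoning

fromℕ-mono-< : ∀ {a b} → a < b → fromℕ a ℚ.< fromℕ b
fromℕ-mono-< {a} {b} a<b = ℚₚ.toℚᵘ-cancel-< (begin-strict
  ℚ.toℚᵘ (fromℕ a) ≃⟨ toℚᵘ-fromℕ a ⟩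
  ℚᵘ.mkℚᵘ (+ a) 0  <⟨ ℚᵘ.*<* (ℤₚ.*-monoʳ-<-pos (+ 1) (ℤ.+<+ a<b)) ⟩
  ℚᵘ.mkℚᵘ (+ b) 0  ≃⟨ toℚᵘ-fromℕ b ⟨
  ℚ.toℚᵘ (fromℕ b) ∎)
  where open ℚᵘₚ.≤-Reasoning

fromℕ-cancel-≤ : ∀ {a b} → fromℕ a ℚ.≤ fromℕ b → a ≤ b
fromℕ-cancel-≤ a≤b = ≮⇒≥ λ b<a → ℚₚ.<-irrefl refl (ℚₚ.<-≤-trans (fromℕ-mono-< b<a) a≤b)

fromℕ-cancel-< : ∀ {a b} → fromℕ a ℚ.< fromℕ b → a < b
fromℕ-cancel-< a<b = ≰⇒> λ b≤a → ℚₚ.<-irrefl refl (ℚₚ.<-≤-trans a<b (fromℕ-mono-≤ b≤a))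

fromℕ-pos : ∀ a .{{_ : NonZero a}} → Positive (fromℕ a)
fromℕ-pos a = ℚₚ.normalize-pos a 1

fromℕ-*-1/ : ∀ d .{{_ : NonZero d}} a → fromℕ d ℚ.* (+ a ℚ./ d) ≡ fromℕ a
fromℕ-*-1/ d@(suc d-1) a = ℚₚ.toℚᵘ-injective (begin
  ℚ.toℚᵘ (fromℕ d ℚ.* (+ a ℚ./ d))             ≈⟨ ℚₚ.toℚᵘ-homo-* (fromℕ d) (+ a ℚ./ d) ⟩
  ℚ.toℚᵘ (fromℕ d) ℚᵘ.* ℚ.toℚᵘ (+ a ℚ./ d)     ≈⟨ ℚᵘₚ.*-cong (toℚᵘ-fromℕ d) (ℚₚ.toℚᵘ-fromℚᵘ (ℚᵘ.mkℚᵘ (+ a) d-1)) ⟩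
  ℚᵘ.mkℚᵘ (+ d) 0 ℚᵘ.* ℚᵘ.mkℚᵘ (+ a) d-1       ≈⟨ ℚᵘ.*≡* eq ⟩
  ℚᵘ.mkℚᵘ (+ a) 0                              ≈⟨ toℚᵘ-fromℕ a ⟨
  ℚ.toℚᵘ (fromℕ a)                             ∎)
  where
  open ℚᵘₚ.≃-Reasoning
  eq : + d ℤ.* + a ℤ.* + 1 ≡ + a ℤ.* (+ 1 ℤ.* + d)
  eq = trans (ℤₚ.*-identityʳ _) (trans (ℤₚ.*-comm (+ d) (+ a)) (cong (+ a ℤ.*_) (sym (ℤₚ.*-identityˡ (+ d)))))

-- `2^ x` may be a proper fraction; a factor 2^c with x + c nonnegative makes it a natural number.
-- Later comparisons with powers of two pass to ℕ in this way.
2^-scale : ∀ x c n → x ℤ.+ + c ≡ + n → fromℕ (2 ^ c) ℚ.* 2^ x ≡ fromℕ (2 ^ n)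
2^-scale (+ a) c n a+c≡n = begin
  fromℕ (2 ^ c) ℚ.* fromℕ (2 ^ a) ≡⟨ fromℕ-homo-* (2 ^ c) (2 ^ a) ⟨
  fromℕ (2 ^ c * 2 ^ a)           ≡⟨ cong fromℕ (^-distribˡ-+-* 2 c a) ⟨
  fromℕ (2 ^ (c + a))             ≡⟨ cong (λ j → fromℕ (2 ^ j)) (trans (+-comm c a) (ℤₚ.+-injective a+c≡n)) ⟩
  fromℕ (2 ^ n)                   ∎
  where open ≡-Reasoning
2^-scale x@(-[1+ a ]) c n x+c≡n = begin
  fromℕ (2 ^ c) ℚ.* 2^ x                              ≡⟨ cong (λ j → fromℕ (2 ^ j) ℚ.* 2^ x) c≡n+a ⟩
  fromℕ (2 ^ (n + suc a)) ℚ.* 2^ x                    ≡⟨ cong (λ j → fromℕ j ℚ.* 2^ x) (^-distribˡ-+-* 2 n (suc a)) ⟩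
  fromℕ (2 ^ n * 2 ^ suc a) ℚ.* 2^ x                  ≡⟨ cong (ℚ._* 2^ x) (fromℕ-homo-* (2 ^ n) (2 ^ suc a)) ⟩
  fromℕ (2 ^ n) ℚ.* fromℕ (2 ^ suc a) ℚ.* 2^ x        ≡⟨ ℚₚ.*-assoc (fromℕ (2 ^ n)) (fromℕ (2 ^ suc a)) (2^ x) ⟩
  fromℕ (2 ^ n) ℚ.* (fromℕ (2 ^ suc a) ℚ.* 2^ x)      ≡⟨ cong (fromℕ (2 ^ n) ℚ.*_) (fromℕ-*-1/ (2 ^ suc a) {{m^n≢0 2 (suc a)}} 1) ⟩
  fromℕ (2 ^ n) ℚ.* 1ℚ                                ≡⟨ ℚₚ.*-identityʳ _ ⟩
  fromℕ (2 ^ n)                                       ∎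
  where
  open ≡-Reasoning
  c≡n+a : c ≡ n + suc a
  c≡n+a = ℤₚ.+-injective (begin
    + c                       ≡⟨ ℤₚ.+-identityˡ (+ c) ⟨
    + 0 ℤ.+ + c               ≡⟨ cong (ℤ._+ + c) (ℤₚ.+-inverseˡ x) ⟨
    + suc a ℤ.+ x ℤ.+ + c     ≡⟨ ℤₚ.+-assoc (+ suc a) x (+ c) ⟩
    + suc a ℤ.+ (x ℤ.+ + c)   ≡⟨ cong (ℤ._+_ (+ suc a)) x+c≡n ⟩
    + suc a ℤ.+ + n           ≡⟨ ℤₚ.+-comm (+ suc a) (+ n) ⟩
    + (n + suc a)             ∎)

-- Binary logarithms

2^⌊log₂n⌋≤n : ∀ n .{{_ : NonZero n}} → 2 ^ ⌊log₂ n ⌋ ≤ n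
2^⌊log₂n⌋≤n n = <-rec (λ n → .{{_ : NonZero n}} → 2 ^ ⌊log₂ n ⌋ ≤ n) step n
  where
  step : ∀ n → (∀ {k} → k < n → .{{_ : NonZero k}} → 2 ^ ⌊log₂ k ⌋ ≤ k) →
         .{{_ : NonZero n}} → 2 ^ ⌊log₂ n ⌋ ≤ n
  step 1 rec = s≤s z≤n
  -- Halving n lowers the logarithm by exactly one, and twice the rounded half is at most n.
  step n@(suc (suc n-2)) rec = begin
    2 ^ ⌊log₂ n ⌋                       ≡⟨ cong (2 ^_) log-n ⟩
    2 * 2 ^ ⌊log₂ ⌊ n /2⌋ ⌋             ≤⟨ *-monoʳ-≤ 2 (rec (⌊n/2⌋<n (suc n-2))) ⟩
    ⌊ n /2⌋ + (⌊ n /2⌋ + 0)             ≡⟨ cong (_+_ ⌊ n /2⌋) (+-identityʳ _) ⟩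
    ⌊ n /2⌋ + ⌊ n /2⌋                   ≤⟨ +-monoʳ-≤ ⌊ n /2⌋ (⌊n/2⌋≤⌈n/2⌉ n) ⟩
    ⌊ n /2⌋ + ⌈ n /2⌉                   ≡⟨ ⌊n/2⌋+⌈n/2⌉≡n n ⟩
    n                                   ∎
    where
    open ≤-Reasoning
    log-n : ⌊log₂ n ⌋ ≡ suc ⌊log₂ ⌊ n /2⌋ ⌋
    log-n = trans (sym (m+[n∸m]≡n (⌊log₂⌋-mono-≤ {2} {n} (s≤s (s≤s z≤n)))))
                  (cong suc (sym (⌊log₂⌊n/2⌋⌋≡⌊log₂n⌋∸1 n)))

2^k≤n⇒k≤⌊log₂n⌋ : ∀ {k n} → 2 ^ k ≤ n → k ≤ ⌊log₂ n ⌋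
2^k≤n⇒k≤⌊log₂n⌋ {k} 2^k≤n = subst (_≤ _) (⌊log₂[2^n]⌋≡n k) (⌊log₂⌋-mono-≤ 2^k≤n)

k≤⌊log₂n⌋⇒2^k≤n : ∀ {k n} .{{_ : NonZero n}} → k ≤ ⌊log₂ n ⌋ → 2 ^ k ≤ n
k≤⌊log₂n⌋⇒2^k≤n {n = n} k≤log = ≤-trans (^-monoʳ-≤ 2 k≤log) (2^⌊log₂n⌋≤n n)

⌊log₂[2^k*n]⌋≡k+⌊log₂n⌋ : ∀ k n .{{_ : NonZero n}} → ⌊log₂ (2 ^ k * n) ⌋ ≡ k + ⌊log₂ n ⌋
⌊log₂[2^k*n]⌋≡k+⌊log₂n⌋ zero    n = cong ⌊log₂_⌋ (+-identityʳ n)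
⌊log₂[2^k*n]⌋≡k+⌊log₂n⌋ (suc k) n = begin
  ⌊log₂ (2 * 2 ^ k * n) ⌋     ≡⟨ cong ⌊log₂_⌋ (*-assoc 2 (2 ^ k) n) ⟩
  ⌊log₂ (2 * (2 ^ k * n)) ⌋   ≡⟨ ⌊log₂[2*b]⌋≡1+⌊log₂b⌋ (2 ^ k * n) {{m*n≢0 (2 ^ k) n {{m^n≢0 2 k}}}} ⟩
  suc ⌊log₂ (2 ^ k * n) ⌋     ≡⟨ cong suc (⌊log₂[2^k*n]⌋≡k+⌊log₂n⌋ k n) ⟩
  suc (k + ⌊log₂ n ⌋)         ∎
  where open ≡-Reasoning

-- Subset sums

-- Hill climbing: while x is not maximal, some admissible y has a larger value of f. Each move gains
-- at least one and f is bounded by b, so b moves suffice.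
greatest : ∀ {A : Set} {P : A → Set} (f : A → ℕ) →
           (∀ v → Dec (∃[ x ] P x × v < f x)) →
           ∀ b → (∀ x → P x → f x ≤ b) → ∃ P →
           ∃[ x ] P x × (∀ y → P y → f y ≤ f x)
greatest {A} {P} f above? b f≤b (x₀ , Px₀) = climb b x₀ Px₀ (m≤n+m b (f x₀))
  where
  climb : ∀ gap x → P x → b ≤ f x + gap → ∃[ x ] P x × (∀ y → P y → f y ≤ f x)
  climb gap x Px b≤ with above? (f x)
  ... | no ¬above = x , Px , λ y Py → ≮⇒≥ λ fx<fy → ¬above (y , Py , fx<fy)
  climb zero x Px b≤ | yes (y , Py , fx<fy) =
    contradiction (≤-trans fx<fy (≤-trans (f≤b y Py) (subst (b ≤_) (+-identityʳ (f x)) b≤))) (<-irrefl refl)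
  climb (suc gap) x Px b≤ | yes (y , Py , fx<fy) =
    climb gap y Py (≤-trans b≤ (≤-trans (≤-reflexive (+-suc (f x) gap)) (+-monoˡ-≤ gap fx<fy)))

sum-mono-≤ : ∀ {n} {f g : Fin n → ℕ} → (∀ i → f i ≤ g i) → sum f ≤ sum g
sum-mono-≤ {zero}  f≤g = z≤n
sum-mono-≤ {suc n} f≤g = +-mono-≤ (f≤g Fin.zero) (sum-mono-≤ (f≤g ∘ Fin.suc))

f[i]≤sum : ∀ {n} (f : Fin n → ℕ) i → f i ≤ sum f
f[i]≤sum f Fin.zero    = m≤m+n _ _
f[i]≤sum f (Fin.suc i) = ≤-trans (f[i]≤sum (f ∘ Fin.suc) i) (m≤n+m _ (f Fin.zero))

sum-const : ∀ n x → sum {n} (λ _ → x) ≡ n * x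
sum-const zero    x = refl
sum-const (suc n) x = cong (_+_ x) (sum-const n x)

∈⇒lookup : ∀ {n} {F : Subset n} {i} → i ∈ F → lookup F i ≡ true
∈⇒lookup = Vecₚ.[]=⇒lookup

lookup⇒∈ : ∀ {n} {F : Subset n} {i} → lookup F i ≡ true → i ∈ F
lookup⇒∈ {F = F} {i} = Vecₚ.lookup⇒[]= i F

∈⟪⟫⁺ : ∀ {n} {P : Fin n → Set} (P? : ∀ i → Dec (P i)) {i} → P i → i ∈ ⟪ P? ⟫
∈⟪⟫⁺ P? {i} Pi = lookup⇒∈ (trans (Vecₚ.lookup∘tabulate (does ∘ P?) i) (dec-true (P? i) Pi))

∈⟪⟫⁻ : ∀ {n} {P : Fin n → Set} (P? : ∀ i → Dec (P i)) {i} → i ∈ ⟪ P? ⟫ → P i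
∈⟪⟫⁻ P? {i} i∈ with P? i | trans (sym (Vecₚ.lookup∘tabulate (does ∘ P?) i)) (∈⇒lookup i∈)
... | yes Pi | _ = Pi

∑-mono-⊆ : ∀ {n} {F G : Subset n} f → F ⊆ G → ∑ F f ≤ ∑ G f
∑-mono-⊆ {F = F} {G} f F⊆G = sum-mono-≤ term
  where
  term : ∀ i → (if lookup F i then f i else 0) ≤ (if lookup G i then f i else 0)
  term i with lookup F i in eq
  ... | false = z≤n
  ... | true rewrite ∈⇒lookup (F⊆G (lookup⇒∈ eq)) = ≤-refl

∑-empty : ∀ {n} {F : Subset n} f → (∀ {i} → i ∉ F) → ∑ F f ≡ 0
∑-empty {n} {F} f F-empty = trans (sum-cong-≗ term) (trans (sum-const n 0) (*-zeroʳ n))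
  where
  term : ∀ i → (if lookup F i then f i else 0) ≡ 0
  term i with lookup F i in eq
  ... | false = refl
  ... | true  = contradiction (lookup⇒∈ eq) F-empty

∑-∪-≤ : ∀ {n} (F G : Subset n) f → ∑ (F ∪ G) f ≤ ∑ F f + ∑ G f
∑-∪-≤ F G f = ≤-trans (sum-mono-≤ term) (≤-reflexive (∑-distrib-+ (λ i → if lookup F i then f i else 0) _))
  where
  term : ∀ i → (if lookup (F ∪ G) i then f i else 0) ≤
               (if lookup F i then f i else 0) + (if lookup G i then f i else 0)
  term i rewrite Vecₚ.lookup-zipWith _∨_ i F G with lookup F i
  ... | true  = m≤m+n _ _
  ... | false = ≤-refl

∑-∪-disjoint : ∀ {n} (F G : Subset n) f → (∀ {i} → i ∈ F → i ∉ G) → ∑ F f + ∑ G f ≤ ∑ (F ∪ G) f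
∑-∪-disjoint F G f disj = ≤-trans (≤-reflexive (sym (∑-distrib-+ (λ i → if lookup F i then f i else 0) _))) (sum-mono-≤ term)
  where
  term : ∀ i → (if lookup F i then f i else 0) + (if lookup G i then f i else 0) ≤
               (if lookup (F ∪ G) i then f i else 0)
  term i rewrite Vecₚ.lookup-zipWith _∨_ i F G with lookup F i in i∈F | lookup G i in i∈G
  ... | false | _     = ≤-refl
  ... | true  | false = ≤-reflexive (+-identityʳ _)
  ... | true  | true  = contradiction (lookup⇒∈ i∈G) (disj (lookup⇒∈ i∈F))

⋃< : ∀ {n} → (ℕ → Subset n) → ℕ → Subset n
⋃< F zero    = ⊥
⋃< F (suc T) = ⋃< F T ∪ F T

∈⋃<⁺ : ∀ {n} (F : ℕ → Subset n) {T t i} → t < T → i ∈ F t → i ∈ ⋃< F T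
∈⋃<⁺ F {suc T} {t} (s≤s t≤T) i∈ with m≤n⇒m<n∨m≡n t≤T
... | inj₁ t<T  = x∈p∪q⁺ (inj₁ (∈⋃<⁺ F t<T i∈))
... | inj₂ refl = x∈p∪q⁺ (inj₂ i∈)

∈⋃<⁻ : ∀ {n} (F : ℕ → Subset n) {T i} → i ∈ ⋃< F T → ∃[ t ] t < T × i ∈ F t
∈⋃<⁻ F {zero}  i∈ = contradiction i∈ ∉⊥
∈⋃<⁻ F {suc T} i∈ with x∈p∪q⁻ (⋃< F T) (F T) i∈
... | inj₁ i∈⋃ = let t , t<T , i∈F = ∈⋃<⁻ F i∈⋃ in t , m≤n⇒m≤1+n t<T , i∈F
... | inj₂ i∈F = T , ≤-refl , i∈F

-- Periodic sums and residue counting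

sum< : ℕ → (ℕ → ℕ) → ℕ
sum< n f = sum {n} (f ∘ toℕ)

sum<-last : ∀ n f → sum< (suc n) f ≡ sum< n f + f n
sum<-last zero    f = +-comm (f 0) 0
sum<-last (suc n) f = begin
  f 0 + sum< (suc n) (f ∘ suc)          ≡⟨ cong (_+_ (f 0)) (sum<-last n (f ∘ suc)) ⟩
  f 0 + (sum< n (f ∘ suc) + f (suc n))  ≡⟨ +-assoc (f 0) _ _ ⟨
  sum< (suc n) f + f (suc n)            ∎
  where open ≡-Reasoning

-- Moving a window of length n by one place drops its first term and gains the term n places later,
-- which is equal by periodicity.
sum<-shift : ∀ n f → (∀ j → f (j + n) ≡ f j) → ∀ a → sum< n (λ c → f (a + c)) ≡ sum< n f
sum<-shift n f periodic zero    = refl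
sum<-shift n f periodic (suc a) = trans step (sum<-shift n f periodic a)
  where
  g : ℕ → ℕ
  g c = f (a + c)
  step : sum< n (λ c → f (suc a + c)) ≡ sum< n g
  step = +-cancelˡ-≡ (g 0) _ _ (begin
    g 0 + sum< n (λ c → f (suc a + c)) ≡⟨ cong (_+_ (g 0)) (sum-cong-≗ {n} λ c → cong f (sym (+-suc a (toℕ c)))) ⟩
    sum< (suc n) g                     ≡⟨ sum<-last n g ⟩
    sum< n g + f (a + n)               ≡⟨ cong (_+_ (sum< n g)) (trans (periodic a) (cong f (sym (+-identityʳ a)))) ⟩
    sum< n g + g 0                     ≡⟨ +-comm _ (g 0) ⟩
    g 0 + sum< n g                     ∎)
    where open ≡-Reasoning

⟦_<_⟧ : ℕ → ℕ → ℕ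
⟦ x < y ⟧ = if does (x <? y) then 1 else 0

count-< : ∀ {l n} → l ≤ n → sum< n (λ c → ⟦ c < l ⟧) ≡ l
count-< {zero}  {n}     _         = trans (sum-const n 0) (*-zeroʳ n)
count-< {suc l} {suc n} (s≤s l≤n) = cong suc (count-< l≤n)

-- While c runs through n consecutive values, a + c meets every residue exactly once, and l of the
-- residues lie below l.
count-residues : ∀ {l} n .{{_ : NonZero n}} → l ≤ n → ∀ a → sum< n (λ c → ⟦ (a + c) % n < l ⟧) ≡ l
count-residues {l} n l≤n a = begin
  sum< n (λ c → ⟦ (a + c) % n < l ⟧)  ≡⟨ sum<-shift n (λ c → ⟦ c % n < l ⟧) (λ j → cong ⟦_< l ⟧ ([m+n]%n≡m%n j n)) a ⟩
  sum< n (λ c → ⟦ c % n < l ⟧)        ≡⟨ sum-cong-≗ {n} (λ c → cong ⟦_< l ⟧ (m<n⇒m%n≡m (Finₚ.toℕ<n c))) ⟩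
  sum< n (λ c → ⟦ c < l ⟧)            ≡⟨ count-< l≤n ⟩
  l                                   ∎
  where open ≡-Reasoning

-- With n = ℓ + q, l = ℓ and `a` the binary logarithm of the bottleneck, these are the tasks that
-- lie in some group with k ≡ - c.
residueClass : ∀ {k} n .{{_ : NonZero n}} → ℕ → (Fin k → ℕ) → ℕ → Subset k
residueClass n l a c = ⟪ (λ i → (a i + c) % n <? l) ⟫

-- After exchanging the two sums, task i is counted once for every c with (a i + c) mod n < l, hence
-- l times.
∑-residueClasses : ∀ {k l} n .{{_ : NonZero n}} → l ≤ n → ∀ (a : Fin k → ℕ) (F : Subset k) f →
                   sum< n (λ c → ∑ (F ∩ residueClass n l a c) f) ≡ l * ∑ F f
∑-residueClasses {k} {l} n l≤n a F f = begin
  sum< n (λ c → ∑ (F ∩ residueClass n l a c) f)                       ≡⟨ sum-cong-≗ {n} (λ c → sum-cong-≗ (term (toℕ c))) ⟩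
  sum {n} (λ c → sum (λ i → ⟦ (a i + toℕ c) % n < l ⟧ * share i))    ≡⟨ ∑-comm {n} (λ c i → ⟦ (a i + toℕ c) % n < l ⟧ * share i) ⟩
  sum (λ i → sum< n (λ c → ⟦ (a i + c) % n < l ⟧ * share i))         ≡⟨ sum-cong-≗ (λ i → *-distribʳ-sum {n} (share i) (λ c → ⟦ (a i + toℕ c) % n < l ⟧)) ⟨
  sum (λ i → sum< n (λ c → ⟦ (a i + c) % n < l ⟧) * share i)         ≡⟨ sum-cong-≗ (λ i → trans (cong (_* share i) (count-residues n l≤n (a i))) (*-comm l (share i))) ⟩
  sum (λ i → share i * l)                                            ≡⟨ *-distribʳ-sum l share ⟨
  ∑ F f * l                                                           ≡⟨ *-comm (∑ F f) l ⟩
  l * ∑ F f                                                           ∎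
  where
  open ≡-Reasoning
  share : Fin k → ℕ
  share i = if lookup F i then f i else 0
  term : ∀ c i → (if lookup (F ∩ residueClass n l a c) i then f i else 0) ≡ ⟦ (a i + c) % n < l ⟧ * share i
  term c i rewrite Vecₚ.lookup-zipWith _∧_ i F (residueClass n l a c)
                 | Vecₚ.lookup∘tabulate (λ i → does ((a i + c) % n <? l)) i
    with lookup F i | does ((a i + c) % n <? l)
  ... | true  | true  = sym (+-identityʳ _)
  ... | true  | false = refl
  ... | false | true  = refl
  ... | false | false = refl

-- Bottleneck edges

m/n-unique : ∀ {x n t} .{{_ : NonZero n}} → t * n ≤ x → x < suc t * n → x / n ≡ t
m/n-unique {x} {n} {t} lo hi = ≤-antisym
  (s≤s⁻¹ (m<n*o⇒m/o<n {o = n} hi))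
  (subst (_≤ x / n) (m*n/n≡m t n) (/-monoˡ-≤ n lo))

module Scheduling (I : Instance) where
  open Instance I

  bottleneckEdge : ∀ i → ∃[ e ] Uses I i e × u e ≡ bottleneck I i
  bottleneckEdge i with argmin-sel id (u (firstEdge I i)) (map u (filter (uses? I i) (allFin m)))
  -- The minimum may be the default value; that is the capacity of the first edge, which the task
  -- uses.
  ... | inj₁ eq = firstEdge I i ,
                  (≤-reflexive (sym (Finₚ.toℕ-fromℕ< _)) , subst (_< toℕ (t i)) (sym (Finₚ.toℕ-fromℕ< _)) (s<t i)) ,
                  sym eq
  ... | inj₂ b∈ with ∈-map⁻ u b∈
  ... | e , e∈ , eq = e , proj₂ (∈-filter⁻ (uses? I i) {xs = allFin m} e∈) , sym eq

  bn : Fin n → Fin m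
  bn i = proj₁ (bottleneckEdge i)

  uses-bn : ∀ i → Uses I i (bn i)
  uses-bn i = proj₁ (proj₂ (bottleneckEdge i))

  u-bn : ∀ i → u (bn i) ≡ bottleneck I i
  u-bn i = proj₂ (proj₂ (bottleneckEdge i))

  bottleneck≢0 : ∀ i → NonZero (bottleneck I i)
  bottleneck≢0 i = >-nonZero (subst (0 <_) (u-bn i) (u>0 (bn i)))

  -- A bottleneck b is at least 2^k iff ⌊log₂ b⌋ ≥ k, so membership in a group depends on b only
  -- through this number.
  lb : Fin n → ℕ
  lb i = ⌊log₂ bottleneck I i ⌋

  ∈T⁺ : ∀ {i e} → Uses I i e → i ∈ T[_] I e
  ∈T⁺ {e = e} = ∈⟪⟫⁺ (λ i → uses? I i e)

  ∈T⁻ : ∀ {i e} → i ∈ T[_] I e → Uses I i e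
  ∈T⁻ {e = e} = ∈⟪⟫⁻ (λ i → uses? I i e)

  load-mono : ∀ {F G} e → F ⊆ G → load I F e ≤ load I G e
  load-mono {F} {G} e F⊆G = ∑-mono-⊆ d λ i∈ → let i∈F , i∈T = x∈p∩q⁻ F _ i∈ in x∈p∩q⁺ (F⊆G i∈F , i∈T)

  load-⊥ : ∀ e → load I ⊥ e ≡ 0
  load-⊥ e = ∑-empty d λ i∈ → ∉⊥ (proj₁ (x∈p∩q⁻ ⊥ _ i∈))

  load-∪-≤ : ∀ F G e → load I (F ∪ G) e ≤ load I F e + load I G e
  load-∪-≤ F G e = ≤-trans
    (≤-reflexive (cong (λ H → ∑ H d) (∩-distribʳ-∪ (T[_] I e) F G)))
    (∑-∪-≤ (F ∩ T[_] I e) (G ∩ T[_] I e) d)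

  -- A task through e reaches its bottleneck edge on the left or on the right
  -- of e, so every such task uses the nearest bottleneck edge on its side.
  load-via-bottlenecks : ∀ z b F e → (∀ {i} → i ∈ F → z * load I F (bn i) ≤ b) →
                         z * load I F e ≤ b + b
  load-via-bottlenecks z b F e bounded = begin
    z * load I F e                      ≤⟨ *-monoʳ-≤ z (≤-trans (∑-mono-⊆ d split) (∑-∪-≤ left right d)) ⟩
    z * (∑ left d + ∑ right d)          ≡⟨ *-distribˡ-+ z (∑ left d) (∑ right d) ⟩
    z * ∑ left d + z * ∑ right d        ≤⟨ +-mono-≤
      -- On the left the nearest bottleneck edge has the largest number. On the right numbers are
      -- subtracted from m, so that the nearest edge is again a maximum.
      (one-side left (toℕ ∘ bn) (Finₚ.toℕ≤n ∘ bn) left⊆)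
      (one-side right (λ i → m ∸ toℕ (bn i)) (λ i → m∸n≤m m (toℕ (bn i))) right⊆) ⟩
    b + b                               ∎
    where
    open ≤-Reasoning
    onLeft? : ∀ i → Dec (toℕ (bn i) ≤ toℕ e)
    onLeft? i = toℕ (bn i) ≤? toℕ e
    onRight? : ∀ i → Dec (toℕ e < toℕ (bn i))
    onRight? i = toℕ e <? toℕ (bn i)

    left right : Subset n
    left  = (F ∩ T[_] I e) ∩ ⟪ onLeft? ⟫
    right = (F ∩ T[_] I e) ∩ ⟪ onRight? ⟫

    split : F ∩ T[_] I e ⊆ left ∪ right
    split {i} i∈ with onLeft? i
    ... | yes ≤e = x∈p∪q⁺ (inj₁ (x∈p∩q⁺ (i∈ , ∈⟪⟫⁺ onLeft? ≤e)))
    ... | no ≰e  = x∈p∪q⁺ (inj₂ (x∈p∩q⁺ (i∈ , ∈⟪⟫⁺ onRight? (≰⇒> ≰e))))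

    -- All of G runs through the bottleneck edge of the maximising task i, so the load bound at that
    -- edge applies to the whole of G.
    one-side : ∀ G (f : Fin n → ℕ) → (∀ i → f i ≤ m) →
               (∀ {i} → i ∈ G → (∀ j → j ∈ G → f j ≤ f i) → i ∈ F × G ⊆ F ∩ T[_] I (bn i)) →
               z * ∑ G d ≤ b
    one-side G f f≤m nearest with nonempty? G
    ... | no empty = subst (_≤ b) (sym (trans (cong (z *_) (∑-empty d λ i∈G → empty (_ , i∈G))) (*-zeroʳ z))) z≤n
    ... | yes nonempty with greatest f (λ v → Finₚ.any? λ i → (i ∈? G) ×-dec (v <? f i)) m (λ i _ → f≤m i) nonempty
    ... | i , i∈G , top = let i∈F , G⊆ = nearest i∈G top in ≤-trans (*-monoʳ-≤ z (∑-mono-⊆ d G⊆)) (bounded i∈F)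

    left⁻ : ∀ {i} → i ∈ left → i ∈ F × Uses I i e × toℕ (bn i) ≤ toℕ e
    left⁻ i∈ = let i∈F∩T , i∈L = x∈p∩q⁻ _ ⟪ onLeft? ⟫ i∈ ; i∈F , i∈T = x∈p∩q⁻ F _ i∈F∩T
               in i∈F , ∈T⁻ i∈T , ∈⟪⟫⁻ onLeft? i∈L

    right⁻ : ∀ {i} → i ∈ right → i ∈ F × Uses I i e × toℕ e < toℕ (bn i)
    right⁻ i∈ = let i∈F∩T , i∈R = x∈p∩q⁻ _ ⟪ onRight? ⟫ i∈ ; i∈F , i∈T = x∈p∩q⁻ F _ i∈F∩T
                in i∈F , ∈T⁻ i∈T , ∈⟪⟫⁻ onRight? i∈R

    -- Task j starts no later than its own bottleneck edge, which is not to the right of `bn i`, and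
    -- it ends beyond e; so it passes `bn i`.
    left⊆ : ∀ {i} → i ∈ left → (∀ j → j ∈ left → toℕ (bn j) ≤ toℕ (bn i)) →
            i ∈ F × left ⊆ F ∩ T[_] I (bn i)
    left⊆ i∈ top = proj₁ (left⁻ i∈) , λ {j} j∈ →
      let j∈F , (_ , e<t) , _ = left⁻ j∈
          _ , _ , i≤e = left⁻ i∈
      in x∈p∩q⁺ (j∈F , ∈T⁺ (≤-trans (proj₁ (uses-bn j)) (top j j∈) , ≤-<-trans i≤e e<t))

    right⊆ : ∀ {i} → i ∈ right → (∀ j → j ∈ right → m ∸ toℕ (bn j) ≤ m ∸ toℕ (bn i)) →
             i ∈ F × right ⊆ F ∩ T[_] I (bn i)
    right⊆ {i} i∈ top = proj₁ (right⁻ i∈) , λ {j} j∈ →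
      let j∈F , (s≤e , _) , _ = right⁻ j∈
          _ , _ , e<i = right⁻ i∈
          bi≤bj = ≮⇒≥ λ bj<bi → ≤⇒≯ (top j j∈) (∸-monoʳ-< bj<bi (Finₚ.toℕ≤n (bn i)))
      in x∈p∩q⁺ (j∈F , ∈T⁺ (≤-trans s≤e (<⇒≤ e<i) , ≤-<-trans bi≤bj (proj₂ (uses-bn j))))

  feasible-⊆ : ∀ {F G} → F ⊆ G → Feasible I G → Feasible I F
  feasible-⊆ F⊆G feasible e = ≤-trans (load-mono e F⊆G) (feasible e)

  -- The approximation guarantee compares with given optimal sets, so one has to exist. Feasibility
  -- is decidable, the empty set is feasible, and `profit I ⊤` bounds all profits.
  optimum : ∀ R → ∃ (IsOPT I R)
  optimum R =
    let O , (O⊆R , feasible) , best = greatest {P = λ G → G ⊆ R × Feasible I G} (profit I)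
          (λ v → anySubset? λ G → ((G ⊆? R) ×-dec Finₚ.all? (λ e → load I G e ≤? u e)) ×-dec (v <? profit I G))
          (profit I ⊤) (λ G _ → ∑-mono-⊆ {F = G} w ⊆⊤)
          (⊥ , ⊥⊆ , λ e → subst (_≤ u e) (sym (load-⊥ e)) z≤n)
    in O , O⊆R , feasible , λ G G⊆R G-feasible → best G (G⊆R , G-feasible)

-- One class of groups

i-j+j≡i : ∀ i j → i ℤ.- j ℤ.+ j ≡ i
i-j+j≡i i j = trans (ℤₚ.+-assoc i (ℤ.- j) j) (trans (cong (ℤ._+_ i) (ℤₚ.+-inverseˡ j)) (ℤₚ.+-identityʳ i))

-- Comparisons with powers of two, cleared of denominators

module _ (x : ℤ) (c n : ℕ) (x+c≡n : x ℤ.+ + c ≡ + n) where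

  private instance
    2^c>0 : Positive (fromℕ (2 ^ c))
    2^c>0 = fromℕ-pos (2 ^ c) {{m^n≢0 2 c}}
    2^c≥0 : NonNegative (fromℕ (2 ^ c))
    2^c≥0 = ℚₚ.pos⇒nonNeg (fromℕ (2 ^ c))

  2^-≤⁻ : ∀ b → 2^ x ℚ.≤ fromℕ b → 2 ^ n ≤ 2 ^ c * b
  2^-≤⁻ b le = fromℕ-cancel-≤ (subst₂ ℚ._≤_ (2^-scale x c n x+c≡n) (sym (fromℕ-homo-* (2 ^ c) b))
    (ℚₚ.*-monoˡ-≤-nonNeg (fromℕ (2 ^ c)) le))

  2^-≤⁺ : ∀ b → 2 ^ n ≤ 2 ^ c * b → 2^ x ℚ.≤ fromℕ b
  2^-≤⁺ b le = ℚₚ.*-cancelˡ-≤-pos (fromℕ (2 ^ c))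
    (subst₂ ℚ._≤_ (sym (2^-scale x c n x+c≡n)) (fromℕ-homo-* (2 ^ c) b) (fromℕ-mono-≤ le))

  2^->⁻ : ∀ b → fromℕ b ℚ.< 2^ x → 2 ^ c * b < 2 ^ n
  2^->⁻ b lt = fromℕ-cancel-< (subst₂ ℚ._<_ (sym (fromℕ-homo-* (2 ^ c) b)) (2^-scale x c n x+c≡n)
    (ℚₚ.*-monoʳ-<-pos (fromℕ (2 ^ c)) lt))

  2^->⁺ : ∀ b → 2 ^ c * b < 2 ^ n → fromℕ b ℚ.< 2^ x
  2^->⁺ b lt = ℚₚ.*-cancelˡ-<-nonNeg (fromℕ (2 ^ c))
    (subst₂ ℚ._<_ (fromℕ-homo-* (2 ^ c) b) (sym (2^-scale x c n x+c≡n)) (fromℕ-mono-< lt))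

-- The factor 2^q turns β = 2^(1-q) into 2, and 2^c turns 2^k into 2^n. The slack β 2^k thus becomes
-- 2^(n+1).
slack-scale : ∀ {q k c n load u} → k ℤ.+ + c ≡ + n →
              fromℕ load ℚ.≤ fromℕ u ℚ.- 2^ (+ 1 - + q) ℚ.* 2^ k →
              2 ^ (q + c) * load + 2 ^ suc n ≤ 2 ^ (q + c) * u
slack-scale {q} {k} {c} {n} {load} {u} k+c≡n load≤ = fromℕ-cancel-≤ (begin
  fromℕ (2 ^ (q + c) * load + 2 ^ suc n)            ≡⟨ fromℕ-homo-+ (2 ^ (q + c) * load) (2 ^ suc n) ⟩
  fromℕ (2 ^ (q + c) * load) ℚ.+ fromℕ (2 ^ suc n)  ≡⟨ cong₂ ℚ._+_ (fromℕ-homo-* (2 ^ (q + c)) load) (sym slack) ⟩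
  z ℚ.* fromℕ load ℚ.+ z ℚ.* βk                     ≡⟨ ℚₚ.*-distribˡ-+ z (fromℕ load) βk ⟨
  z ℚ.* (fromℕ load ℚ.+ βk)                         ≤⟨ ℚₚ.*-monoˡ-≤-nonNeg z (ℚₚ.+-monoˡ-≤ βk load≤) ⟩
  z ℚ.* (fromℕ u ℚ.- βk ℚ.+ βk)                     ≡⟨ cong (z ℚ.*_) cancel ⟩
  z ℚ.* fromℕ u                                     ≡⟨ fromℕ-homo-* (2 ^ (q + c)) u ⟨
  fromℕ (2 ^ (q + c) * u)                           ∎)
  where
  open ℚₚ.≤-Reasoning
  z βk : ℚ
  z  = fromℕ (2 ^ (q + c))
  βk = 2^ (+ 1 - + q) ℚ.* 2^ k
  instance
    z≥0 : NonNegative z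
    z≥0 = ℚₚ.normalize-nonNeg (2 ^ (q + c)) 1
  cancel : fromℕ u ℚ.- βk ℚ.+ βk ≡ fromℕ u
  cancel = trans (ℚₚ.+-assoc (fromℕ u) (ℚ.- βk) βk)
             (trans (cong (fromℕ u ℚ.+_) (ℚₚ.+-inverseˡ βk)) (ℚₚ.+-identityʳ (fromℕ u)))
  interchange : ∀ a b x y → a ℚ.* b ℚ.* (x ℚ.* y) ≡ a ℚ.* x ℚ.* (b ℚ.* y)
  interchange a b x y = trans (ℚₚ.*-assoc a b (x ℚ.* y))
    (trans (cong (a ℚ.*_) (trans (sym (ℚₚ.*-assoc b x y))
      (trans (cong (ℚ._* y) (ℚₚ.*-comm b x)) (ℚₚ.*-assoc x b y)))) (sym (ℚₚ.*-assoc a x (b ℚ.* y))))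
  slack : z ℚ.* βk ≡ fromℕ (2 ^ suc n)
  slack = ≡-Reasoning.begin
    z ℚ.* βk
      ≡-Reasoning.≡⟨ cong (λ y → fromℕ y ℚ.* βk) (^-distribˡ-+-* 2 q c) ⟩
    fromℕ (2 ^ q * 2 ^ c) ℚ.* βk
      ≡-Reasoning.≡⟨ cong (ℚ._* βk) (fromℕ-homo-* (2 ^ q) (2 ^ c)) ⟩
    fromℕ (2 ^ q) ℚ.* fromℕ (2 ^ c) ℚ.* βk
      ≡-Reasoning.≡⟨ interchange (fromℕ (2 ^ q)) (fromℕ (2 ^ c)) (2^ (+ 1 - + q)) (2^ k) ⟩
    fromℕ (2 ^ q) ℚ.* 2^ (+ 1 - + q) ℚ.* (fromℕ (2 ^ c) ℚ.* 2^ k)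
      ≡-Reasoning.≡⟨ cong₂ ℚ._*_ (2^-scale (+ 1 - + q) q 1 (i-j+j≡i (+ 1) (+ q))) (2^-scale k c n k+c≡n) ⟩
    fromℕ 2 ℚ.* fromℕ (2 ^ n)
      ≡-Reasoning.≡⟨ fromℕ-homo-* 2 (2 ^ n) ⟨
    fromℕ (2 ^ suc n) ≡-Reasoning.∎

-- Bounds with a common factor r add up. The optimum may be split into overlapping parts, hence p ≤
-- o + o′; profits of the solution must not be counted twice, hence f + f′ ≤ p′.
ratio-add : ∀ r .{{_ : NonNegative r}} o o′ f f′ {p p′} → p ≤ o + o′ → f + f′ ≤ p′ →
            fromℕ o ℚ.≤ r ℚ.* fromℕ f → fromℕ o′ ℚ.≤ r ℚ.* fromℕ f′ →
            fromℕ p ℚ.≤ r ℚ.* fromℕ p′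
ratio-add r o o′ f f′ {p} {p′} p≤ ≤p′ o≤ o′≤ = begin
  fromℕ p                            ≤⟨ fromℕ-mono-≤ p≤ ⟩
  fromℕ (o + o′)                     ≡⟨ fromℕ-homo-+ o o′ ⟩
  fromℕ o ℚ.+ fromℕ o′               ≤⟨ ℚₚ.+-mono-≤ o≤ o′≤ ⟩
  r ℚ.* fromℕ f ℚ.+ r ℚ.* fromℕ f′   ≡⟨ ℚₚ.*-distribˡ-+ r (fromℕ f) (fromℕ f′) ⟨
  r ℚ.* (fromℕ f ℚ.+ fromℕ f′)       ≡⟨ cong (r ℚ.*_) (fromℕ-homo-+ f f′) ⟨
  r ℚ.* fromℕ (f + f′)               ≤⟨ ℚₚ.*-monoˡ-≤-nonNeg r (fromℕ-mono-≤ ≤p′) ⟩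
  r ℚ.* fromℕ p′                     ∎
  where open ℚₚ.≤-Reasoning

ratio-mono : ∀ r .{{_ : NonNegative r}} {o o′ f f′} → o ≤ o′ → f′ ≤ f →
             fromℕ o′ ℚ.≤ r ℚ.* fromℕ f′ → fromℕ o ℚ.≤ r ℚ.* fromℕ f
ratio-mono r o≤o′ f′≤f o′≤ =
  ℚₚ.≤-trans (fromℕ-mono-≤ o≤o′) (ℚₚ.≤-trans o′≤ (ℚₚ.*-monoˡ-≤-nonNeg r (fromℕ-mono-≤ f′≤f)))

module Class (I : Instance) (l q c : ℕ) where
  open Instance I
  open Scheduling I

  ℓ L : ℕ
  ℓ = suc l
  L = ℓ + q

  -- Class c collects the groups F^{k,ℓ} with k ≡ − c modulo ℓ + q.
  K : ℕ → ℤ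
  K t = + (t * L) - + c

  K+c : ∀ t → K t ℤ.+ + c ≡ + (t * L)
  K+c t = i-j+j≡i (+ (t * L)) (+ c)

  K+ℓ+c : ∀ t → K t ℤ.+ + ℓ ℤ.+ + c ≡ + (t * L + ℓ)
  K+ℓ+c t = trans (ℤₚ.+-assoc (K t) (+ ℓ) (+ c)) (trans (cong (ℤ._+_ (K t)) (ℤₚ.+-comm (+ ℓ) (+ c)))
    (trans (sym (ℤₚ.+-assoc (K t) (+ c) (+ ℓ))) (cong (ℤ._+ + ℓ) (K+c t))))

  g : ℕ → Subset n
  g t = group I (K t) ℓ

  inGroup? : ∀ t i → Dec (2^ K t ℚ.≤ fromℕ (bottleneck I i) × fromℕ (bottleneck I i) ℚ.< 2^ (K t ℤ.+ + ℓ))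
  inGroup? t i = (2^ K t ℚ.≤? fromℕ (bottleneck I i)) ×-dec (fromℕ (bottleneck I i) ℚ.<? 2^ (K t ℤ.+ + ℓ))

  ∈g⇒bounds : ∀ t i → i ∈ g t → 2 ^ (t * L) ≤ 2 ^ c * bottleneck I i × 2 ^ c * bottleneck I i < 2 ^ (t * L + ℓ)
  ∈g⇒bounds t i i∈ = let lo , hi = ∈⟪⟫⁻ (inGroup? t) {i} i∈ in 2^-≤⁻ (K t) c (t * L) (K+c t) _ lo , 2^->⁻ (K t ℤ.+ + ℓ) c (t * L + ℓ) (K+ℓ+c t) _ hi

  log-scaled : ∀ i → ⌊log₂ 2 ^ c * bottleneck I i ⌋ ≡ lb i + c
  log-scaled i = trans (⌊log₂[2^k*n]⌋≡k+⌊log₂n⌋ c _ {{bottleneck≢0 i}}) (+-comm c (lb i))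

  scaled≢0 : ∀ i → NonZero (2 ^ c * bottleneck I i)
  scaled≢0 i = m*n≢0 (2 ^ c) (bottleneck I i) {{m^n≢0 2 c}} {{bottleneck≢0 i}}

  -- The only index whose group can contain task i. Natural indices suffice: bottlenecks are at
  -- least 1, so lb i + c is nonnegative.
  τ : Fin n → ℕ
  τ i = (lb i + c) / L

  -- The bounds of the group put lb i + c into [tL, tL + ℓ), which lies within one period of length
  -- L. Hence the groups of a class are pairwise disjoint.
  ∈g⇒τ : ∀ t {i} → i ∈ g t → τ i ≡ t
  ∈g⇒τ t {i} i∈ = m/n-unique
    (subst (t * L ≤_) (log-scaled i) (2^k≤n⇒k≤⌊log₂n⌋ (proj₁ (∈g⇒bounds t i i∈))))
    (<-≤-trans (subst (_< t * L + ℓ) (log-scaled i)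
        (≰⇒> λ ≤log → <⇒≱ (proj₂ (∈g⇒bounds t i i∈)) (k≤⌊log₂n⌋⇒2^k≤n {t * L + ℓ} {{scaled≢0 i}} ≤log)))
      (≤-trans (+-monoʳ-≤ (t * L) (m≤m+n ℓ q)) (≤-reflexive (+-comm (t * L) L))))

  -- Remainders from ℓ to L - 1 are the gap of q scales between consecutive groups; a smaller
  -- remainder puts the task into the group of its quotient.
  residue⇒∈g : ∀ {i} → (lb i + c) % L < ℓ → i ∈ g (τ i)
  residue⇒∈g {i} r<ℓ = ∈⟪⟫⁺ (inGroup? (τ i))
    ( 2^-≤⁺ (K (τ i)) c (τ i * L) (K+c (τ i)) (bottleneck I i) (k≤⌊log₂n⌋⇒2^k≤n {{scaled≢0 i}} (subst (τ i * L ≤_) (sym (log-scaled i)) (m/n*n≤m (lb i + c) L)))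
    , 2^->⁺ (K (τ i) ℤ.+ + ℓ) c (τ i * L + ℓ) (K+ℓ+c (τ i)) (bottleneck I i) (≰⇒> λ ≤scaled → <⇒≱ log< (subst (τ i * L + ℓ ≤_) (log-scaled i) (2^k≤n⇒k≤⌊log₂n⌋ ≤scaled))))
    where
    log< : lb i + c < τ i * L + ℓ
    log< = subst (_< τ i * L + ℓ) (trans (+-comm (τ i * L) _) (sym (m≡m%n+[m/n]*n (lb i + c) L))) (+-monoʳ-< (τ i * L) r<ℓ)

  module Union (F : ℕ → Subset n)
    (F⊆g : ∀ t → F t ⊆ g t)
    (slack : ∀ t e → Nonempty (T[_] I e ∩ g t) → fromℕ (load I (F t) e) ℚ.≤ fromℕ (u e) ℚ.- 2^ (+ 1 - + q) ℚ.* 2^ K t)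
    (S : Subset n)
    (S⊆F : ∀ {i} → i ∈ S → ∃[ t ] i ∈ F t)
    -- S contains the sets of the groups to which edge capacities point, which is what one call per
    -- edge provides.
    (F⊆S : ∀ e → F ((⌊log₂ u e ⌋ + c) / L) ⊆ S)
    where

    -- A common unit: 2^c clears `2^ (K t)` and 2^q clears β, so that the load estimates can be made
    -- in ℕ.
    z : ℕ
    z = 2 ^ (q + c)

    load-slack : ∀ t e {i} → i ∈ g t → Uses I i e → z * load I (F t) e + 2 ^ suc (t * L) ≤ z * u e
    load-slack t e {i} i∈g used = slack-scale {q} {K t} {c} {t * L} (K+c t) (slack t e (i , x∈p∩q⁺ (∈T⁺ used , i∈g)))

    -- The reason for L = ℓ + q: the factor 2^q lifts the upper end 2^(tL+ℓ) of group t to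
    -- 2^((t+1)L), half of the scaled slack of group t + 1.
    cap< : ∀ t i → i ∈ g t → z * u (bn i) ≤ 2 ^ (suc t * L)
    cap< t i i∈ = begin
      z * u (bn i)                      ≡⟨ cong₂ _*_ (^-distribˡ-+-* 2 q c) (u-bn i) ⟩
      2 ^ q * 2 ^ c * bottleneck I i    ≡⟨ *-assoc (2 ^ q) (2 ^ c) _ ⟩
      2 ^ q * (2 ^ c * bottleneck I i)  ≤⟨ *-monoʳ-≤ (2 ^ q) (<⇒≤ (proj₂ (∈g⇒bounds t i i∈))) ⟩
      2 ^ q * 2 ^ (t * L + ℓ)           ≡⟨ ^-distribˡ-+-* 2 q (t * L + ℓ) ⟨
      2 ^ (q + (t * L + ℓ))             ≡⟨ cong (2 ^_) (trans (+-comm q _) (trans (+-assoc (t * L) ℓ q) (+-comm (t * L) L))) ⟩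
      2 ^ (suc t * L)                   ∎
      where open ≤-Reasoning

    -- Here lo is the scaled slack of group t and hi bounds the scaled capacity of its bottleneck
    -- edges. F t puts at most hi - lo on each of these, hence at most 2 (hi - lo) on e; adding lo
    -- gives at most 2 hi, the slack of the next group.
    group-load : ∀ t e → 2 ^ suc (t * L) + z * load I (F t) e ≤ 2 ^ suc (suc t * L)
    group-load t e = begin
      lo + z * load I (F t) e       ≤⟨ +-monoʳ-≤ lo (load-via-bottlenecks z (hi ∸ lo) (F t) e bounded) ⟩
      lo + ((hi ∸ lo) + (hi ∸ lo))  ≡⟨ +-assoc lo (hi ∸ lo) (hi ∸ lo) ⟨
      lo + (hi ∸ lo) + (hi ∸ lo)    ≡⟨ cong (_+ (hi ∸ lo)) (m+[n∸m]≡n lo≤hi) ⟩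
      hi + (hi ∸ lo)                ≤⟨ +-monoʳ-≤ hi (m∸n≤m hi lo) ⟩
      hi + hi                       ≡⟨ cong (_+_ hi) (+-identityʳ hi) ⟨
      2 ^ suc (suc t * L)           ∎
      where
      open ≤-Reasoning
      lo hi : ℕ
      lo = 2 ^ suc (t * L)
      hi = 2 ^ (suc t * L)
      lo≤hi : lo ≤ hi
      -- The exponents compare because L ≥ 1.
      lo≤hi = ^-monoʳ-≤ 2 {suc (t * L)} {suc t * L} (+-monoˡ-≤ (t * L) (s≤s z≤n))
      bounded : ∀ {i} → i ∈ F t → z * load I (F t) (bn i) ≤ hi ∸ lo
      bounded {i} i∈F = let i∈g = F⊆g t i∈F in
        m+n≤o⇒m≤o∸n _ (≤-trans (load-slack t (bn i) i∈g (uses-bn i)) (cap< t i i∈g))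

    -- The right side is the scaled slack of group T. It bounds the load on every edge, whatever its
    -- capacity, so the induction runs over T alone.
    load-below : ∀ T e → z * load I (⋃< F T) e ≤ 2 ^ suc (T * L)
    load-below zero    e = subst (_≤ 2) (sym (trans (cong (z *_) (load-⊥ e)) (*-zeroʳ z))) z≤n
    load-below (suc T) e = begin
      z * load I (⋃< F T ∪ F T) e                   ≤⟨ *-monoʳ-≤ z (load-∪-≤ (⋃< F T) (F T) e) ⟩
      z * (load I (⋃< F T) e + load I (F T) e)      ≡⟨ *-distribˡ-+ z (load I (⋃< F T) e) (load I (F T) e) ⟩
      z * load I (⋃< F T) e + z * load I (F T) e    ≤⟨ +-monoˡ-≤ (z * load I (F T) e) (load-below T e) ⟩
      2 ^ suc (T * L) + z * load I (F T) e          ≤⟨ group-load T e ⟩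
      2 ^ suc (suc T * L)                           ∎
      where open ≤-Reasoning

    -- The highest group with a task on e decides: if F T has none there, the load is that of the
    -- lower groups; otherwise F T leaves enough slack on e for all of them.
    ⋃-feasible : ∀ T → Feasible I (⋃< F T)
    ⋃-feasible zero    e = subst (_≤ u e) (sym (load-⊥ e)) z≤n
    ⋃-feasible (suc T) e = extend (nonempty? (F T ∩ T[_] I e))
      where
      open ≤-Reasoning
      extend : Dec (Nonempty (F T ∩ T[_] I e)) → load I (⋃< F T ∪ F T) e ≤ u e
      extend (no empty) = begin
        load I (⋃< F T ∪ F T) e                       ≤⟨ load-∪-≤ (⋃< F T) (F T) e ⟩
        load I (⋃< F T) e + load I (F T) e            ≡⟨ cong (_+_ (load I (⋃< F T) e)) (∑-empty {F = F T ∩ T[_] I e} d λ i∈ → empty (_ , i∈)) ⟩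
        load I (⋃< F T) e + 0                         ≡⟨ +-identityʳ (load I (⋃< F T) e) ⟩
        load I (⋃< F T) e                             ≤⟨ ⋃-feasible T e ⟩
        u e                                           ∎
      extend (yes (i , i∈)) = *-cancelˡ-≤ {load I (⋃< F T ∪ F T) e} {u e} z {{m^n≢0 2 (q + c)}} (begin
        z * load I (⋃< F T ∪ F T) e                   ≤⟨ *-monoʳ-≤ z (load-∪-≤ (⋃< F T) (F T) e) ⟩
        z * (load I (⋃< F T) e + load I (F T) e)      ≡⟨ *-distribˡ-+ z (load I (⋃< F T) e) (load I (F T) e) ⟩
        z * load I (⋃< F T) e + z * load I (F T) e    ≤⟨ +-monoˡ-≤ (z * load I (F T) e) (load-below T e) ⟩
        2 ^ suc (T * L) + z * load I (F T) e          ≡⟨ +-comm (2 ^ suc (T * L)) (z * load I (F T) e) ⟩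
        z * load I (F T) e + 2 ^ suc (T * L)          ≤⟨ (let i∈F , i∈T = x∈p∩q⁻ (F T) _ i∈ in load-slack T e (F⊆g T i∈F) (∈T⁻ i∈T)) ⟩
        z * u e                                       ∎)

    top : ℕ
    top = suc (sum τ)

    τ<top : ∀ i → τ i < top
    τ<top i = s≤s (f[i]≤sum τ i)

    feasible : Feasible I S
    feasible = feasible-⊆ (λ {i} i∈S → let t , i∈F = S⊆F i∈S in
      ∈⋃<⁺ F (subst (_< top) (∈g⇒τ _ (F⊆g t i∈F)) (τ<top i)) i∈F) (⋃-feasible top)

    -- A task of F t lies in group t, so t is the index computed from the capacity of its bottleneck
    -- edge, and for that index S contains F t.
    ⋃⊆S : ∀ T → ⋃< F T ⊆ S
    ⋃⊆S T {i} i∈⋃ =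
      let t , _ , i∈F = ∈⋃<⁻ F {T} i∈⋃
          t≡ = trans (sym (∈g⇒τ _ (F⊆g t i∈F))) (cong (λ b → (⌊log₂ b ⌋ + c) / L) (sym (u-bn i)))
      in F⊆S (bn i) (subst (λ t → i ∈ F t) t≡ i∈F)

    module Profit (r : ℚ) .{{_ : NonNegative r}}
      (good : ∀ t O → IsOPT I (g t) O → fromℕ (profit I O) ℚ.≤ r ℚ.* fromℕ (profit I (F t)))
      (O : Subset n) (O-feasible : Feasible I O)
      where

      -- The part of O inside the group is feasible and therefore competes with the optimum of the
      -- group.
      good′ : ∀ t → fromℕ (profit I (O ∩ g t)) ℚ.≤ r ℚ.* fromℕ (profit I (F t))
      good′ t = let P , opt@(_ , _ , best) = optimum (g t) in
        ℚₚ.≤-trans (fromℕ-mono-≤ {profit I (O ∩ g t)} {profit I P} (best (O ∩ g t) (p∩q⊆q O (g t)) (feasible-⊆ (p∩q⊆p O (g t)) O-feasible)))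
          (good t P opt)

      ⋃-profit : ∀ T → fromℕ (profit I (O ∩ ⋃< g T)) ℚ.≤ r ℚ.* fromℕ (profit I (⋃< F T))
      ⋃-profit zero = ℚₚ.≤-reflexive (trans
        (cong fromℕ (∑-empty {F = O ∩ ⊥} w λ i∈ → ∉⊥ (proj₂ (x∈p∩q⁻ O ⊥ i∈))))
        (sym (trans (cong (λ x → r ℚ.* fromℕ x) (∑-empty {F = ⊥} w ∉⊥)) (ℚₚ.*-zeroʳ r))))
      ⋃-profit (suc T) = ratio-add r
        (profit I (O ∩ ⋃< g T)) (profit I (O ∩ g T)) (profit I (⋃< F T)) (profit I (F T))
        (≤-trans (≤-reflexive (cong (profit I) (∩-distribˡ-∪ O (⋃< g T) (g T)))) (∑-∪-≤ (O ∩ ⋃< g T) (O ∩ g T) w))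
        (∑-∪-disjoint (⋃< F T) (F T) w disjoint)
        (⋃-profit T) (good′ T)
        where
        disjoint : ∀ {i} → i ∈ ⋃< F T → i ∉ F T
        disjoint i∈⋃ i∈F =
          let t , t<T , i∈F′ = ∈⋃<⁻ F {T} i∈⋃
          in <-irrefl (trans (sym (∈g⇒τ _ (F⊆g t i∈F′))) (∈g⇒τ _ (F⊆g T i∈F))) t<T

      class-profit : fromℕ (profit I (O ∩ residueClass L ℓ lb c)) ℚ.≤ r ℚ.* fromℕ (profit I S)
      class-profit = ratio-mono r {o′ = profit I (O ∩ ⋃< g top)} {f′ = profit I (⋃< F top)}
        (∑-mono-⊆ w covered) (∑-mono-⊆ w (⋃⊆S top)) (⋃-profit top)
        where
        covered : O ∩ residueClass L ℓ lb c ⊆ O ∩ ⋃< g top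
        covered {i} i∈ = let i∈O , i∈R = x∈p∩q⁻ O _ i∈ in
          x∈p∩q⁺ (i∈O , ∈⋃<⁺ g (τ<top i) (residue⇒∈g (∈⟪⟫⁻ (λ i → (lb i + c) % L <? ℓ) {i} i∈R)))

-- Programs

+[m+n]-+m≡+n : ∀ m n → + (m + n) - + m ≡ + n
+[m+n]-+m≡+n m n = begin
  + m ℤ.+ + n ℤ.- + m      ≡⟨ cong (ℤ._- + m) (ℤₚ.+-comm (+ m) (+ n)) ⟩
  + n ℤ.+ + m ℤ.- + m      ≡⟨ ℤₚ.+-assoc (+ n) (+ m) (ℤ.- + m) ⟩
  + n ℤ.+ (+ m ℤ.- + m)    ≡⟨ cong (ℤ._+_ (+ n)) (ℤₚ.+-inverseʳ (+ m)) ⟩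
  + n ℤ.+ + 0              ≡⟨ ℤₚ.+-identityʳ (+ n) ⟩
  + n                      ∎
  where open ≡-Reasoning

bit : Bool → ℤ
bit b = if b then 1ℤ else 0ℤ

read-toℕ : ∀ {n} (f : Fin n → ℤ) i → read f (+ toℕ i) ≡ f i
read-toℕ {n} f i with toℕ i <? n
... | yes i<n = cong f (Finₚ.fromℕ<-toℕ i i<n)
... | no  i≮n = contradiction (Finₚ.toℕ<n i) i≮n

length-encode : ∀ {n} (F : Subset n) → length (encode F) ≡ n
length-encode []      = refl
length-encode (_ ∷ F) = cong suc (length-encode F)

read-suc : ∀ x (xs : List ℤ) j → read (List.lookup (x ∷ xs)) (+ suc j) ≡ read (List.lookup xs) (+ j)
read-suc x xs j with j <? length xs
... | yes j< = read-fromℕ< (s≤s j<)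
  where
  read-fromℕ< : ∀ (p : suc j < suc (length xs)) → read (List.lookup (x ∷ xs)) (+ suc j) ≡ List.lookup (x ∷ xs) (fromℕ< p)
  read-fromℕ< p = trans (cong (λ i → read (List.lookup (x ∷ xs)) (+ i)) (sym (Finₚ.toℕ-fromℕ< p))) (read-toℕ (List.lookup (x ∷ xs)) (fromℕ< p))
... | no j≮ with suc j <? suc (length xs)
...   | yes (s≤s j<) = contradiction j< j≮
...   | no _ = refl

read-encode : ∀ {n} (F : Subset n) i → read (List.lookup (encode F)) (+ toℕ i) ≡ bit (lookup F i)
read-encode (b ∷ F) Fin.zero    = read-toℕ (List.lookup (encode (b ∷ F))) Fin.zero
read-encode (b ∷ F) (Fin.suc i) = trans (read-suc (bit b) (encode F) (toℕ i)) (read-encode F i)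

drop-encode : ∀ {n} (F : Subset n) i → drop (toℕ i) (encode F) ≡ bit (lookup F i) ∷ drop (suc (toℕ i)) (encode F)
drop-encode (b ∷ F) Fin.zero    = refl
drop-encode (b ∷ F) (Fin.suc i) = drop-encode F i

drop-all-encode : ∀ {n} (F : Subset n) → drop n (encode F) ≡ []
drop-all-encode []      = refl
drop-all-encode (_ ∷ F) = drop-all-encode F

quot-∨ : ∀ a b → quot (bit a ℤ.+ bit b ℤ.+ 1ℤ) (+ 2) ≡ bit (a ∨ b)
quot-∨ true  true  = refl
quot-∨ true  false = refl
quot-∨ false true  = refl
quot-∨ false false = refl

quot-bit : ∀ w b → quot (+ w) (bit b) ≡ + (if b then w else 0)
quot-bit w true  = trans (ℤₚ.*-identityˡ (+ (w / 1))) (cong +_ (n/1≡n w))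
quot-bit w false = refl

prefix : ∀ {n} → (Fin n → ℕ) → ℕ → ℕ
prefix f j = sum (λ i → if does (toℕ i <? j) then f i else 0)

prefix-zero : ∀ {n} (f : Fin n → ℕ) → prefix f 0 ≡ 0
prefix-zero {n} f = trans (sum-const n 0) (*-zeroʳ n)

prefix-suc : ∀ {n} (f : Fin n → ℕ) i → prefix f (suc (toℕ i)) ≡ prefix f (toℕ i) + f i
prefix-suc f Fin.zero    = +-comm (f Fin.zero) _
prefix-suc f (Fin.suc i) = trans (cong (_+_ (f Fin.zero)) (prefix-suc (f ∘ Fin.suc) i)) (sym (+-assoc (f Fin.zero) _ _))

prefix-all : ∀ {n} (f : Fin n → ℕ) → prefix f n ≡ sum f
prefix-all {n} f = sum-cong-≗ λ i → cong (if_then f i else 0) (dec-true (toℕ i <? n) (Finₚ.toℕ<n i))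

-- Every output symbol is paid for by an `emit`, which costs at least one step.
out-length : ∀ {X I} {P : Com X} {σ τ c} → I ⊢ P , σ ⇓ τ ⟨ c ⟩ → length (out τ) ≤ length (out σ) + c
out-length ⇓skip = m≤m+n _ _
out-length ⇓≔    = m≤m+n _ _
out-length ⇓[]≔  = m≤m+n _ _
out-length (⇓emit {σ} {e}) = ≤-trans (≤-reflexive (Listₚ.length-++ (out σ))) (+-monoʳ-≤ (length (out σ)) (s≤s z≤n))
out-length (⇓⨾ {σ = σ} {c = c} P Q) = ≤-trans (out-length Q)
  (≤-trans (+-monoˡ-≤ _ (out-length P)) (≤-reflexive (+-assoc (length (out σ)) c _)))
out-length (⇓then {σ = σ} {e = e} {c = c} _ P) = ≤-trans (out-length P) (+-monoʳ-≤ (length (out σ)) (m≤n+m c (1 + cost e)))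
out-length (⇓else {σ = σ} {e = e} {c = c} _ P) = ≤-trans (out-length P) (+-monoʳ-≤ (length (out σ)) (m≤n+m c (1 + cost e)))
out-length (⇓done _) = m≤m+n _ _
out-length (⇓loop {σ = σ} {e = e} {c = c} {c′ = c′} _ P W) = ≤-trans (out-length W)
  (≤-trans (+-monoˡ-≤ c′ (out-length P)) (≤-trans (≤-reflexive (+-assoc (length (out σ)) c c′))
    (+-monoʳ-≤ (length (out σ)) (+-monoˡ-≤ c′ (m≤n+m c (1 + cost e))))))
out-length (⇓call _) = m≤m+n _ _

n≤cost : ∀ {X I} {P : Com X} {k F c} → Outputs P I k F c → Instance.n I ≤ c
n≤cost {F = F} (τ , run , out≡) = subst (_≤ _) (trans (cong length out≡) (length-encode F)) (out-length run)

-- Loops and the combined algorithm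

for : ∀ {X} → ℕ → Expr X → Com X → Com X
for x N P = x ≔ lit 0ℤ ⨾ (whilepos N ⊖ reg x loop (P ⨾ x ≔ reg x ⊕ lit 1ℤ))

emitArray : ∀ {X} → ℕ → Com X
emitArray a = for 2 #tasks (emit (arr a (reg 2)))

-- On bits, (x + y + 1) / 2 is the disjunction of x and y.
mergeArrays : ∀ {X} → Com X
mergeArrays = for 2 #tasks (0 [ reg 2 ]≔ (arr 0 (reg 2) ⊕ arr 1 (reg 2) ⊕ lit 1ℤ) ⊘ lit (+ 2))

-- The largest k ≤ log u_e with k ≡ − c modulo L, for the edge e in register 1:
-- only this group of class c can contain tasks whose bottleneck edge is e.
scaleExpr : ∀ {X} → ℕ → ℕ → Expr X
scaleExpr L c = log₂ (capacity (reg 1)) ⊖ (log₂ (capacity (reg 1)) ⊕ lit (+ c)) mod lit (+ L)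

-- Array 0 accumulates the union and array 1 receives the output of each call. Registers 1 and 2
-- keep the counters of the nested loops apart.
classUnion : ∀ {X} → ℕ → Com X → ℕ → Com X
classUnion L A c =
  for 1 #edges (call 1 A (scaleExpr L c) ⨾ mergeArrays) ⨾
  emitArray 0

-- Division by a characteristic bit keeps or drops the weight, as x / 0 = 0.
better : ∀ {X} → Com X → Com X → Com X
better P Q =
  call 0 P (lit 0ℤ) ⨾
  call 1 Q (lit 0ℤ) ⨾
  for 2 #tasks (1 ≔ reg 1 ⊕ weight (reg 2) ⊘ arr 1 (reg 2) ⊖ weight (reg 2) ⊘ arr 0 (reg 2)) ⨾
  (ifpos reg 1 then emitArray 1 else emitArray 0)

-- The constant 2 pays for resetting the counter and 4 for its increment; the test is evaluated once
-- more than the body.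
forCost : ∀ {X} → Expr X → ℕ → ℕ → ℕ
forCost N k b = 2 + (k * (test + (b + 4)) + test)
  where
  test : ℕ
  test = 1 + (1 + cost N + 1)

-- H is the condition that the instance has enough tasks, the only case in
-- which running times are bounded.
module Runs {X : Extension} (I : Instance) (H : Set) where
  open Instance I

  -- A Hoare triple of total correctness with time bound b. Halting and Q are unconditional; the
  -- bound is claimed under H.
  Run : Com X → State → ℕ → (State → Set) → Set
  Run P σ b Q = ∃[ τ ] ∃[ c ] (I ⊢ P , σ ⇓ τ ⟨ c ⟩) × Q τ × (H → c ≤ b)

  run-≔ : ∀ {x e σ Q} → Q (setReg x (eval I σ e) σ) → Run (x ≔ e) σ (1 + cost e) Q
  run-≔ q = _ , _ , ⇓≔ , q , λ _ → ≤-refl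

  run-[]≔ : ∀ {a e f σ Q} → Q (setCell a (eval I σ e) (eval I σ f) σ) → Run (a [ e ]≔ f) σ (1 + cost e + cost f) Q
  run-[]≔ q = _ , _ , ⇓[]≔ , q , λ _ → ≤-refl

  run-emit : ∀ {e σ Q} → Q (record σ { out = out σ ∷ʳ eval I σ e }) → Run (emit e) σ (1 + cost e) Q
  run-emit q = _ , _ , ⇓emit , q , λ _ → ≤-refl

  run-⨾ : ∀ {P P′ σ b b′ Q R} → Run P σ b Q → (∀ τ → Q τ → Run P′ τ b′ R) → Run (P ⨾ P′) σ (b + b′) R
  run-⨾ (τ , _ , ⇓P , q , c≤) next =
    let υ , _ , ⇓P′ , r , c′≤ = next τ q in υ , _ , ⇓⨾ ⇓P ⇓P′ , r , λ h → +-mono-≤ (c≤ h) (c′≤ h)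

  run-if : ∀ {e P P′ σ b Q} → (0ℤ ℤ.< eval I σ e → Run P σ b Q) → (eval I σ e ℤ.≤ 0ℤ → Run P′ σ b Q) →
           Run (ifpos e then P else P′) σ (1 + cost e + b) Q
  run-if {e} {σ = σ} t f with eval I σ e ℤₚ.≤? 0ℤ
  ... | yes ≤0 = let _ , _ , ⇓P , q , c≤ = f ≤0 in _ , _ , ⇓else ≤0 ⇓P , q , λ h → +-monoʳ-≤ (1 + cost e) (c≤ h)
  ... | no ≰0 = let >0 = ℤₚ.≰⇒> ≰0 ; _ , _ , ⇓P , q , c≤ = t >0 in _ , _ , ⇓then >0 ⇓P , q , λ h → +-monoʳ-≤ (1 + cost e) (c≤ h)

  Computes : Com X → ℤ → Subset n → ℕ → Set
  Computes P k F b = ∃[ c ] Outputs P I k F c × (H → c ≤ b)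

  Holds : ℕ → Subset n → State → Set
  Holds a F σ = ∀ i → arrs σ a (+ toℕ i) ≡ bit (lookup F i)

  run-call : ∀ {P a e σ F b Q} → Computes P (eval I σ e) F b →
             (∀ f → (∀ i → f (+ toℕ i) ≡ bit (lookup F i)) → Q (setArr a f σ)) →
             Run (call a P e) σ (1 + cost e + b) Q
  run-call {e = e} {F = F} (c , (τ , ⇓P , out≡) , c≤) q =
    _ , _ , ⇓call ⇓P ,
    q _ (λ i → trans (cong (λ xs → read (List.lookup xs) (+ toℕ i)) out≡) (read-encode F i)) ,
    λ h → +-monoʳ-≤ (1 + cost e) (c≤ h)

  module _ {x : ℕ} {N : Expr X} {k : ℕ} (N≡k : ∀ σ → eval I σ N ≡ + k)
           {P : Com X} {b : ℕ} (Inv : ℕ → State → Set)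
           -- The loop itself writes register x, so the invariant has to survive any change of it.
           (skip-x : ∀ {j σ} v → Inv j σ → Inv j (setReg x v σ))
           (step : ∀ (i : Fin k) σ → regs σ x ≡ + toℕ i → Inv (toℕ i) σ →
                   Run P σ b (λ τ → regs τ x ≡ + toℕ i × Inv (suc (toℕ i)) τ))
           where

    private
      test round : ℕ
      test  = 1 + cost (N ⊖ reg x)
      round = test + (b + 4)

      regs-set : ∀ v σ → regs (setReg x v σ) x ≡ v
      regs-set v σ = cong (if_then v else regs σ x) (dec-true (x ≟ x) refl)

      remaining : ∀ j r σ → j + r ≡ k → regs σ x ≡ + j → eval I σ (N ⊖ reg x) ≡ + r
      remaining j r σ j+r≡k x≡j = trans (cong₂ ℤ._-_ (trans (N≡k σ) (cong +_ (sym j+r≡k))) x≡j) (+[m+n]-+m≡+n j r)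

      -- Induction on the number r of remaining rounds, which is also the value of the loop test.
      iterate : ∀ r j → j + r ≡ k → ∀ σ → regs σ x ≡ + j → Inv j σ →
             Run (whilepos N ⊖ reg x loop (P ⨾ x ≔ reg x ⊕ lit 1ℤ)) σ (r * round + test) (Inv k)
      iterate zero j j≡k σ x≡j inv =
        σ , test , ⇓done (subst (ℤ._≤ 0ℤ) (sym (remaining j 0 σ j≡k x≡j)) ℤₚ.≤-refl) ,
        subst (λ j → Inv j σ) (trans (sym (+-identityʳ j)) j≡k) inv , λ _ → ≤-refl
      iterate (suc r) j j+r≡k σ x≡j inv =
        let j<k = subst (suc j ≤_) j+r≡k (≤-trans (m≤m+n (suc j) r) (≤-reflexive (sym (+-suc j r))))
            i = fromℕ< j<k
            i≡j = Finₚ.toℕ-fromℕ< j<k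
            τ , c , ⇓P , (x≡i , inv′) , c≤ = step i σ (trans x≡j (cong +_ (sym i≡j))) (subst (λ j → Inv j σ) (sym i≡j) inv)
            next = eval {X} I τ (reg x ⊕ lit 1ℤ)
            next≡ : next ≡ + suc j
            next≡ = trans (cong (ℤ._+ 1ℤ) (trans x≡i (cong +_ i≡j))) (cong +_ (+-comm j 1))
            υ , c′ , ⇓W , inv″ , c′≤ = iterate r (suc j) (trans (sym (+-suc j r)) j+r≡k) (setReg x next τ)
              (trans (regs-set next τ) next≡) (skip-x next (subst (λ j → Inv (suc j) τ) i≡j inv′))
        in υ , _ ,
           ⇓loop (subst (0ℤ ℤ.<_) (sym (remaining j (suc r) σ j+r≡k x≡j)) (ℤ.+<+ (s≤s z≤n))) (⇓⨾ ⇓P ⇓≔) ⇓W ,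
           inv″ ,
           λ h → ≤-trans (+-mono-≤ (+-monoʳ-≤ test (+-monoˡ-≤ 4 (c≤ h))) (c′≤ h))
                         (≤-reflexive (sym (+-assoc round (r * round) test)))

    run-for : ∀ {σ} → Inv 0 σ → Run (for x N P) σ (forCost N k b) (Inv k)
    run-for {σ} inv = run-⨾ {b = 2} {Q = λ τ → regs τ x ≡ + 0 × Inv 0 τ}
      (run-≔ (regs-set 0ℤ σ , skip-x 0ℤ inv))
      (λ τ (x≡0 , inv) → iterate k 0 refl τ x≡0 inv)

  run-emitArray : ∀ {a F σ} → Holds a F σ → out σ ≡ [] →
                  Run (emitArray a) σ (forCost {X} #tasks n 3) (λ τ → out τ ≡ encode F)
  run-emitArray {a} {F} {σ} holds out≡[] =
    let τ , c , ⇓ , (_ , inv) , c≤ = run-for (λ _ → refl) Inv (λ _ inv → inv) step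
          {σ} (holds , cong (_++ encode F) out≡[])
    in τ , c , ⇓ , trans (sym (Listₚ.++-identityʳ (out τ))) (trans (cong (out τ ++_) (sym (drop-all-encode F))) inv) , c≤
    where
    Inv : ℕ → State → Set
    -- At j = 0 the second part holds for empty output; at j = n it says that the output is
    -- complete.
    Inv j τ = Holds a F τ × out τ ++ drop j (encode F) ≡ encode F
    step : ∀ i τ → regs τ 2 ≡ + toℕ i → Inv (toℕ i) τ →
           Run (emit (arr a (reg 2))) τ 3 (λ υ → regs υ 2 ≡ + toℕ i × Inv (suc (toℕ i)) υ)
    step i τ r≡i (holds , inv) = run-emit (r≡i , holds , (begin
      (out τ ∷ʳ arrs τ a (regs τ 2)) ++ drop (suc (toℕ i)) (encode F)  ≡⟨ Listₚ.++-assoc (out τ) _ _ ⟩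
      out τ ++ arrs τ a (regs τ 2) ∷ drop (suc (toℕ i)) (encode F)     ≡⟨ cong (λ v → out τ ++ v ∷ drop (suc (toℕ i)) (encode F)) (trans (cong (arrs τ a) r≡i) (holds i)) ⟩
      out τ ++ bit (lookup F i) ∷ drop (suc (toℕ i)) (encode F)        ≡⟨ cong (out τ ++_) (drop-encode F i) ⟨
      out τ ++ drop (toℕ i) (encode F)                                 ≡⟨ inv ⟩
      encode F                                                         ∎))
      where open ≡-Reasoning

  run-mergeArrays : ∀ {F G σ} → Holds 0 F σ → Holds 1 G σ →
                    Run mergeArrays σ (forCost {X} #tasks n 11)
                      (λ τ → Holds 0 (F ∪ G) τ × regs τ 1 ≡ regs σ 1 × out τ ≡ out σ)
  run-mergeArrays {F} {G} {σ} holds₀ holds₁ =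
    let τ , c , ⇓ , (_ , done , _ , frame) , c≤ = run-for (λ _ → refl) Inv (λ _ inv → inv) step
          {σ} (holds₁ , (λ _ ()) , (λ i _ → holds₀ i) , refl , refl)
    in τ , c , ⇓ , ((λ i → done i (Finₚ.toℕ<n i)) , frame) , c≤
    where
    Inv : ℕ → State → Set
    -- The merge is in place: cells from j on still hold F, so the old value of the current cell is
    -- known when it is overwritten.
    Inv j τ = Holds 1 G τ ×
              (∀ i → toℕ i < j → arrs τ 0 (+ toℕ i) ≡ bit (lookup (F ∪ G) i)) ×
              (∀ i → j ≤ toℕ i → arrs τ 0 (+ toℕ i) ≡ bit (lookup F i)) ×
              regs τ 1 ≡ regs σ 1 × out τ ≡ out σ
    step : ∀ i τ → regs τ 2 ≡ + toℕ i → Inv (toℕ i) τ →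
           Run (0 [ reg 2 ]≔ (arr 0 (reg 2) ⊕ arr 1 (reg 2) ⊕ lit 1ℤ) ⊘ lit (+ 2)) τ 11
             (λ υ → regs υ 2 ≡ + toℕ i × Inv (suc (toℕ i)) υ)
    step i τ r≡i (holds₁ , done , todo , frame) =
      run-[]≔ (r≡i , holds₁ , done′ , todo′ , frame)
      where
      v : ℤ
      v = quot (arrs τ 0 (regs τ 2) ℤ.+ arrs τ 1 (regs τ 2) ℤ.+ 1ℤ) (+ 2)
      v≡ : v ≡ bit (lookup (F ∪ G) i)
      v≡ = begin
        v                                                                 ≡⟨ cong (λ x → quot (arrs τ 0 x ℤ.+ arrs τ 1 x ℤ.+ 1ℤ) (+ 2)) r≡i ⟩
        quot (arrs τ 0 (+ toℕ i) ℤ.+ arrs τ 1 (+ toℕ i) ℤ.+ 1ℤ) (+ 2)     ≡⟨ cong₂ (λ x y → quot (x ℤ.+ y ℤ.+ 1ℤ) (+ 2)) (todo i ≤-refl) (holds₁ i) ⟩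
        quot (bit (lookup F i) ℤ.+ bit (lookup G i) ℤ.+ 1ℤ) (+ 2)         ≡⟨ quot-∨ (lookup F i) (lookup G i) ⟩
        bit (lookup F i ∨ lookup G i)                                     ≡⟨ cong bit (Vecₚ.lookup-zipWith _∨_ i F G) ⟨
        bit (lookup (F ∪ G) i)                                            ∎
        where open ≡-Reasoning
      υ : State
      υ = setCell 0 (regs τ 2) v τ
      at : ∀ j → toℕ j ≡ toℕ i → arrs υ 0 (+ toℕ j) ≡ v
      at j j≡i = cong (if_then v else arrs τ 0 (+ toℕ j)) (dec-true (regs τ 2 ℤ.≟ + toℕ j) (trans r≡i (cong +_ (sym j≡i))))
      away : ∀ j → toℕ j ≢ toℕ i → arrs υ 0 (+ toℕ j) ≡ arrs τ 0 (+ toℕ j)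
      away j j≢i = cong (if_then v else arrs τ 0 (+ toℕ j)) (dec-false (regs τ 2 ℤ.≟ + toℕ j) λ eq → j≢i (ℤₚ.+-injective (trans (sym eq) r≡i)))
      done′ : ∀ j → toℕ j < suc (toℕ i) → arrs υ 0 (+ toℕ j) ≡ bit (lookup (F ∪ G) j)
      done′ j (s≤s j≤i) with m≤n⇒m<n∨m≡n j≤i
      ... | inj₁ j<i = trans (away j (<⇒≢ j<i)) (done j j<i)
      ... | inj₂ j≡i = trans (at j j≡i) (trans v≡ (cong (λ j → bit (lookup (F ∪ G) j)) (sym (Finₚ.toℕ-injective j≡i))))
      todo′ : ∀ j → toℕ i < toℕ j → arrs υ 0 (+ toℕ j) ≡ bit (lookup F j)
      todo′ j i<j = trans (away j (>⇒≢ i<j)) (todo j (<⇒≤ i<j))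

  -- The scales k e stay abstract here, and S is described by the two inclusions from which
  -- `Class.Union` draws its conclusions.
  computes-classUnion : ∀ {A a} L c (F : ℤ → Subset n) → (∀ k → Computes A k (F k) a) → (k : Fin m → ℤ) →
    (∀ e σ → regs σ 1 ≡ + toℕ e → eval {X} I σ (scaleExpr L c) ≡ k e) →
    ∃[ S ] Computes (classUnion L A c) 0ℤ S (forCost {X} #edges m (12 + a + forCost {X} #tasks n 11) + forCost {X} #tasks n 3) ×
           (∀ i → i ∈ S → ∃[ e ] i ∈ F (k e)) × (∀ e → F (k e) ⊆ S)
  computes-classUnion {A} {a} L c F A-computes k scale =
    let τ , c , ⇓for , ((S , holds , S⊆F , F⊆S) , out≡[]) , c≤ =
          run-for (λ _ → refl) Inv (λ _ inv → inv) step {initial 0ℤ} ((⊥ , (λ i → cong bit (sym (Vecₚ.lookup-replicate i false))) , (λ _ i∈⊥ → contradiction i∈⊥ ∉⊥) , (λ _ ())) , refl)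
        υ , c′ , ⇓out , out≡ , c′≤ = run-emitArray holds out≡[]
    in S , (_ , (υ , ⇓⨾ ⇓for ⇓out , out≡) , λ h → +-mono-≤ (c≤ h) (c′≤ h)) , S⊆F , λ e → F⊆S e (Finₚ.toℕ<n e)
    where
    body : Com X
    body = call 1 A (scaleExpr L c) ⨾ mergeArrays
    Inv : ℕ → State → Set
    Inv j τ = (∃[ S ] Holds 0 S τ × (∀ i → i ∈ S → ∃[ e ] i ∈ F (k e)) × (∀ e → toℕ e < j → F (k e) ⊆ S)) ×
              out τ ≡ []
    -- 12 is the cost of `scaleExpr` plus one for the call; 11 is the cost of one merging
    -- assignment.
    step : ∀ e τ → regs τ 1 ≡ + toℕ e → Inv (toℕ e) τ →
           Run body τ (12 + a + forCost {X} #tasks n 11) (λ υ → regs υ 1 ≡ + toℕ e × Inv (suc (toℕ e)) υ)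
    step e τ r≡e ((S , holds , S⊆F , F⊆S) , out≡[]) =
      run-⨾ {b = 12 + a} {Q = λ υ → Holds 0 S υ × Holds 1 (F (k e)) υ × regs υ 1 ≡ + toℕ e × out υ ≡ []}
        (run-call (subst (λ k → Computes A k (F k) a) (sym (scale e τ r≡e)) (A-computes _))
          (λ f f≡ → holds , (λ i → trans (f≡ i) (cong (λ k → bit (lookup (F k) i)) (scale e τ r≡e))) , r≡e , out≡[]))
        λ υ (holds₀ , holds₁ , r≡e , out≡[]) →
          let φ , c , ⇓ , (holds , r≡ , out≡) , c≤ = run-mergeArrays {S} {F (k e)} {υ} holds₀ holds₁
          in φ , c , ⇓ , (trans r≡ r≡e , (S ∪ F (k e) , holds , from , into) , trans out≡ out≡[]) , c≤
      where
      from : ∀ i → i ∈ S ∪ F (k e) → ∃[ e ] i ∈ F (k e)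
      from i i∈ with x∈p∪q⁻ S (F (k e)) i∈
      ... | inj₁ i∈S = S⊆F i i∈S
      ... | inj₂ i∈F = e , i∈F
      into : ∀ e′ → toℕ e′ < suc (toℕ e) → F (k e′) ⊆ S ∪ F (k e)
      into e′ (s≤s e′≤e) with m≤n⇒m<n∨m≡n e′≤e
      ... | inj₁ e′<e = λ i∈ → p⊆p∪q (F (k e)) (F⊆S e′ e′<e i∈)
      ... | inj₂ e′≡e rewrite Finₚ.toℕ-injective e′≡e = q⊆p∪q S (F (k e))

  computes-better : ∀ {P Q F G b b′} → Computes P 0ℤ F b → Computes Q 0ℤ G b′ →
    ∃[ S ] Computes (better P Q) 0ℤ S ((2 + b) + ((2 + b′) + (forCost {X} #tasks n 14 + (2 + forCost {X} #tasks n 3)))) ×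
           (S ≡ F ⊎ S ≡ G) × profit I F ≤ profit I S × profit I G ≤ profit I S
  computes-better {P} {Q} {F} {G} {b} {b′} P-computes Q-computes =
    let τ , c , ⇓ , (S , out≡ , choice , F≤S , G≤S) , c≤ = run
    in S , (c , (τ , ⇓ , out≡) , c≤) , choice , F≤S , G≤S
    where
    share : Subset n → Fin n → ℕ
    share S i = if lookup S i then w i else 0
    Compared : ℕ → State → Set
    Compared j τ = Holds 0 F τ × Holds 1 G τ × regs τ 1 ≡ + prefix (share G) j - + prefix (share F) j × out τ ≡ []
    Result : State → Set
    Result τ = ∃[ S ] out τ ≡ encode S × (S ≡ F ⊎ S ≡ G) × profit I F ≤ profit I S × profit I G ≤ profit I S
    gain : Expr X
    gain = reg 1 ⊕ weight (reg 2) ⊘ arr 1 (reg 2) ⊖ weight (reg 2) ⊘ arr 0 (reg 2)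

    rearrange : ∀ a b x y → a ℤ.- b ℤ.+ x ℤ.- y ≡ (a ℤ.+ x) ℤ.- (b ℤ.+ y)
    rearrange = ℤ-Solver.solve-∀

    step : ∀ i τ → regs τ 2 ≡ + toℕ i → Compared (toℕ i) τ →
           Run (1 ≔ gain) τ 14 (λ υ → regs υ 2 ≡ + toℕ i × Compared (suc (toℕ i)) υ)
    step i τ r≡i (holds₀ , holds₁ , diff , out≡[]) = run-≔ (r≡i , holds₀ , holds₁ , diff′ , out≡[])
      where
      weighed : ∀ a S → Holds a S τ → quot (read (λ j → + w j) (regs τ 2)) (arrs τ a (regs τ 2)) ≡ + share S i
      weighed a S holds = trans (cong (λ x → quot (read (λ j → + w j) x) (arrs τ a x)) r≡i)
        (trans (cong₂ quot (read-toℕ (λ j → + w j) i) (holds i)) (quot-bit (w i) (lookup S i)))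
      diff′ : eval I τ gain ≡ + prefix (share G) (suc (toℕ i)) - + prefix (share F) (suc (toℕ i))
      diff′ = begin
        eval I τ gain
          ≡⟨ cong₂ ℤ._-_ (cong₂ ℤ._+_ diff (weighed 1 G holds₁)) (weighed 0 F holds₀) ⟩
        + prefix (share G) (toℕ i) - + prefix (share F) (toℕ i) ℤ.+ + share G i - + share F i
          ≡⟨ rearrange (+ prefix (share G) (toℕ i)) (+ prefix (share F) (toℕ i)) (+ share G i) (+ share F i) ⟩
        + (prefix (share G) (toℕ i) + share G i) - + (prefix (share F) (toℕ i) + share F i)
          ≡⟨ cong₂ (λ x y → + x - + y) (prefix-suc (share G) i) (prefix-suc (share F) i) ⟨
        + prefix (share G) (suc (toℕ i)) - + prefix (share F) (suc (toℕ i))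
          ∎
        where open ≡-Reasoning

    -- At j = n the prefix sums are the full profits, so the sign of register 1 decides; a tie
    -- selects F.
    select : ∀ τ → Compared n τ → Run (ifpos reg 1 then emitArray 1 else emitArray 0) τ (2 + forCost {X} #tasks n 3) Result
    select τ (holds₀ , holds₁ , diff , out≡[]) = run-if
      (λ >0 → let υ , c , ⇓ , out≡ , c≤ = run-emitArray holds₁ out≡[]
              in υ , c , ⇓ , (G , out≡ , inj₂ refl , ℤₚ.drop‿+≤+ (ℤₚ.0≤i-j⇒j≤i (subst (0ℤ ℤ.≤_) diff′ (ℤₚ.<⇒≤ >0))) , ≤-refl) , c≤)
      (λ ≤0 → let υ , c , ⇓ , out≡ , c≤ = run-emitArray holds₀ out≡[]
              in υ , c , ⇓ , (F , out≡ , inj₁ refl , ≤-refl , ℤₚ.drop‿+≤+ (ℤₚ.i-j≤0⇒i≤j (subst (ℤ._≤ 0ℤ) diff′ ≤0))) , c≤)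
      where
      diff′ : regs τ 1 ≡ + profit I G - + profit I F
      diff′ = trans diff (cong₂ (λ x y → + x - + y) (prefix-all (share G)) (prefix-all (share F)))

    run : Run (better P Q) (initial 0ℤ) ((2 + b) + ((2 + b′) + (forCost {X} #tasks n 14 + (2 + forCost {X} #tasks n 3)))) Result
    run = run-⨾ {b = 2 + b} {Q = λ τ → Holds 0 F τ × regs τ 1 ≡ 0ℤ × out τ ≡ []}
      (run-call P-computes λ f f≡ → f≡ , refl , refl) λ τ (holds₀ , r≡0 , out≡[]) →
      run-⨾ {b = 2 + b′} {Q = Compared 0}
        (run-call Q-computes λ f f≡ → holds₀ , f≡ ,
          trans r≡0 (sym (cong₂ (λ x y → + x - + y) (prefix-zero (share G)) (prefix-zero (share F)))) , out≡[]) λ υ compared →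
        run-⨾ {Q = Compared n} (run-for (λ _ → refl) Compared (λ _ inv → inv) step compared) select

-- Averaging over the classes

ratio-sum : ∀ r .{{_ : NonNegative r}} n (f : ℕ → ℕ) b →
            (∀ c → c < n → fromℕ (f c) ℚ.≤ r ℚ.* fromℕ b) →
            fromℕ (sum< n f) ℚ.≤ r ℚ.* fromℕ (n * b)
ratio-sum r zero    f b f≤ = ℚₚ.≤-reflexive (sym (ℚₚ.*-zeroʳ r))
ratio-sum r (suc n) f b f≤ = ratio-add r (f 0) (sum< n (f ∘ suc)) b (n * b) ≤-refl ≤-refl
  (f≤ 0 (s≤s z≤n)) (ratio-sum r n (f ∘ suc) b (λ c c<n → f≤ (suc c) (s≤s c<n)))

-- A negative or zero r would lie on both sides of the cut α. Nonnegativity lets profit inequalities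
-- be multiplied by r.
upper-nonNeg : ∀ {α r} → Positiveᴿ α → ℝ.U α r → NonNegative r
upper-nonNeg {α} {r} α>0 Ur with ℚₚ.<-cmp r 0ℚ
... | tri< r<0 _ _  = contradiction (ℝ.L-down α r<0 α>0 , Ur) (ℝ.disjoint α)
... | tri≈ _ refl _ = contradiction (α>0 , Ur) (ℝ.disjoint α)
... | tri> _ _ r>0  = ℚ.nonNegative (ℚₚ.<⇒≤ r>0)

-- With κ = b / a, r lies above κ α iff κ⁻¹ r lies above α. Since a κ = b, the right side equals a r
-- w, and a cancels.
ratio-unscale : ∀ a b .{{_ : NonZero a}} .{{_ : ℚ.NonZero (+ b ℚ./ a)}} r o w →
  fromℕ (a * o) ℚ.≤ (1/ (+ b ℚ./ a)) ℚ.* r ℚ.* fromℕ (b * w) → fromℕ o ℚ.≤ r ℚ.* fromℕ w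
ratio-unscale a b r o w le = ℚₚ.*-cancelˡ-≤-pos (fromℕ a) {{fromℕ-pos a}} (begin
  fromℕ a ℚ.* fromℕ o                                   ≡⟨ fromℕ-homo-* a o ⟨
  fromℕ (a * o)                                         ≤⟨ le ⟩
  κ⁻¹ ℚ.* r ℚ.* fromℕ (b * w)                           ≡⟨ cong (κ⁻¹ ℚ.* r ℚ.*_) (trans (fromℕ-homo-* b w) (cong (ℚ._* fromℕ w) (sym (fromℕ-*-1/ a b)))) ⟩
  κ⁻¹ ℚ.* r ℚ.* (fromℕ a ℚ.* κ ℚ.* fromℕ w)             ≡⟨ shuffle κ⁻¹ r (fromℕ a) κ (fromℕ w) ⟩
  κ⁻¹ ℚ.* κ ℚ.* (fromℕ a ℚ.* (r ℚ.* fromℕ w))           ≡⟨ cong (ℚ._* (fromℕ a ℚ.* (r ℚ.* fromℕ w))) (ℚₚ.*-inverseˡ κ) ⟩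
  1ℚ ℚ.* (fromℕ a ℚ.* (r ℚ.* fromℕ w))                  ≡⟨ ℚₚ.*-identityˡ _ ⟩
  fromℕ a ℚ.* (r ℚ.* fromℕ w)                           ∎)
  where
  open ℚₚ.≤-Reasoning
  κ κ⁻¹ : ℚ
  κ = + b ℚ./ a
  κ⁻¹ = 1/ κ
  shuffle : ∀ k r a k′ w → k ℚ.* r ℚ.* (a ℚ.* k′ ℚ.* w) ≡ k ℚ.* k′ ℚ.* (a ℚ.* (r ℚ.* w))
  shuffle = solve 5 (λ k r a k′ w → k :* r :* (a :* k′ :* w) := k :* k′ :* (a :* (r :* w))) refl
    where open import Data.Rational.Solver using (module +-*-Solver); open +-*-Solver

best : ∀ {X} → (ℕ → Com X) → ℕ → Com X
best P zero    = P 0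
best P (suc c) = better (best P c) (P (suc c))

-- The bounds of computes-classUnion and computes-better with forCost evaluated.
unionCost : ℕ → ℕ → ℕ → ℕ
unionCost m n a = 2 + (m * (4 + (12 + a + (2 + (n * 19 + 4)) + 4)) + 4) + (2 + (n * 11 + 4))

betterCost : ℕ → ℕ → ℕ → ℕ
betterCost n b b′ = (2 + b) + ((2 + b′) + ((2 + (n * 22 + 4)) + (2 + (2 + (n * 11 + 4)))))

unionCost≡ : ∀ m n a → unionCost m n a ≡ 12 + 26 * m + m * a + 19 * (m * n) + 11 * n
unionCost≡ = expand
  where
  expand : ∀ m n a → 2 + (m * (4 + (12 + a + (2 + (n * 19 + 4)) + 4)) + 4) + (2 + (n * 11 + 4)) ≡
                     12 + 26 * m + m * a + 19 * (m * n) + 11 * n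
  expand = ℕ-Solver.solve-∀

-- Running times as multiples of m a

module _ {m n a : ℕ} (m>0 : 0 < m) (n>0 : 0 < n) (n≤a : n ≤ a) where

  private
    Y : ℕ
    Y = m * a

    n≤Y : n ≤ Y
    n≤Y = ≤-trans n≤a (m≤n*m a m {{>-nonZero m>0}})

    1≤Y : 1 ≤ Y
    1≤Y = ≤-trans n>0 n≤Y

    m≤Y : m ≤ Y
    m≤Y = m≤m*n m a {{>-nonZero (≤-trans n>0 n≤a)}}

  -- Each monomial is at most m a, because m ≥ 1 and 1 ≤ n ≤ a; the constant is 12 + 26 + 1 + 19 +
  -- 11.
  unionCost≤ : unionCost m n a ≤ 69 * (m * a)
  unionCost≤ = begin
    unionCost m n a                                        ≡⟨ unionCost≡ m n a ⟩
    12 + 26 * m + m * a + 19 * (m * n) + 11 * n            ≤⟨ +-mono-≤ (+-mono-≤ (+-mono-≤ (+-mono-≤ (*-monoʳ-≤ 12 1≤Y) (*-monoʳ-≤ 26 m≤Y)) ≤-refl) (*-monoʳ-≤ 19 (*-monoʳ-≤ m n≤a))) (*-monoʳ-≤ 11 n≤Y) ⟩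
    12 * Y + 26 * Y + Y + 19 * Y + 11 * Y                  ≡⟨ collect Y ⟩
    69 * Y                                                 ∎
    where
    open ≤-Reasoning
    collect : ∀ y → 12 * y + 26 * y + y + 19 * y + 11 * y ≡ 69 * y
    collect = ℕ-Solver.solve-∀

  -- 51 = 18 + 33 covers the two calls, the comparing loop, the branch and the output.
  betterCost≤ : ∀ {b b′} k k′ → b ≤ k * (m * a) → b′ ≤ k′ * (m * a) →
    betterCost n b b′ ≤ (k + k′ + 51) * (m * a)
  betterCost≤ {b} {b′} k k′ b≤ b′≤ = begin
    betterCost n b b′                   ≡⟨ expand b b′ n ⟩
    b + b′ + 18 + 33 * n                                                    ≤⟨ +-mono-≤ (+-mono-≤ (+-mono-≤ b≤ b′≤) (*-monoʳ-≤ 18 1≤Y)) (*-monoʳ-≤ 33 n≤Y) ⟩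
    k * Y + k′ * Y + 18 * Y + 33 * Y                                        ≡⟨ collect k k′ Y ⟩
    (k + k′ + 51) * Y                                                       ∎
    where
    open ≤-Reasoning
    expand : ∀ b b′ n → (2 + b) + ((2 + b′) + ((2 + (n * 22 + 4)) + (2 + (2 + (n * 11 + 4))))) ≡ b + b′ + 18 + 33 * n
    expand = ℕ-Solver.solve-∀
    collect : ∀ k k′ y → k * y + k′ * y + 18 * y + 33 * y ≡ (k + k′ + 51) * y
    collect = ℕ-Solver.solve-∀

-- In units of m a, each of the c + 1 classes costs 69 and each of the c comparisons 51.
κ : ℕ → ℕ
κ zero    = 69
κ (suc c) = κ c + 69 + 51

tasks⇒edges : ∀ I → 0 < Instance.n I → 0 < Instance.m I
tasks⇒edges I n>0 = ≤-trans (s≤s z≤n) (Finₚ.toℕ<n (firstEdge I (fromℕ< n>0)))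

module Combine {X : Extension} (l q : ℕ) (α : ℝ) (α>0 : Positiveᴿ α) (A : Com X)
  (I : Instance) (H : Set) (a : ℕ)
  (n>0 : H → 0 < Instance.n I)
  (solve : ∀ k → ∃[ F ] ∃[ c ] Outputs A I k F c × Approximative I α (2^ (+ 1 - + q)) k (suc l) F × (H → c ≤ a))
  where
  open Instance I
  open Runs {X} I H
  open Scheduling I

  ℓ L : ℕ
  ℓ = suc l
  L = ℓ + q

  F : ℤ → Subset n
  F k = proj₁ (solve k)

  F-approximative : ∀ k → Approximative I α (2^ (+ 1 - + q)) k ℓ (F k)
  F-approximative k = let _ , _ , _ , approx , _ = solve k in approx

  F-computed : ∀ k → Computes A k (F k) a
  F-computed k = let _ , c , outputs , _ , c≤ = solve k in c , outputs , c≤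

  -- The call for k = 0 already writes n symbols within its time bound a.
  n≤a : H → n ≤ a
  n≤a h = let c , outputs , c≤ = F-computed 0ℤ in ≤-trans (n≤cost outputs) (c≤ h)

  m>0 : H → 0 < m
  m>0 h = tasks⇒edges I (n>0 h)

  -- The left side is the value of `scaleExpr` at x = ⌊log₂ u e⌋; the right side is `K` at the
  -- quotient, so the program calls A for a group of class c.
  scale≡ : ∀ x c → + x - + ((x + c) % L) ≡ + ((x + c) / L * L) - + c
  scale≡ x c = begin
    + x - + r                          ≡⟨ insert (+ x) (+ c) (+ r) ⟩
    + (x + c) - + r - + c              ≡⟨ cong (λ y → + y - + r - + c) (m≡m%n+[m/n]*n (x + c) L) ⟩
    + (r + (x + c) / L * L) - + r - + c  ≡⟨ cong (ℤ._- + c) (+[m+n]-+m≡+n r _) ⟩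
    + ((x + c) / L * L) - + c          ∎
    where
    open ≡-Reasoning
    r : ℕ
    r = (x + c) % L
    insert : ∀ x c r → x ℤ.- r ≡ x ℤ.+ c ℤ.- r ℤ.- c
    insert = ℤ-Solver.solve-∀

  -- The real α is replaced by its rational upper bounds r. O ranges over all feasible sets so that
  -- one optimum of the whole instance can be cut by every class.
  Covers : ℕ → Subset n → Set
  Covers c S = ∀ r → ℝ.U α r → ∀ O → Feasible I O →
    fromℕ (profit I (O ∩ residueClass L ℓ lb c)) ℚ.≤ r ℚ.* fromℕ (profit I S)

  class : ∀ c → ∃[ S ] Computes (classUnion L A c) 0ℤ S (unionCost m n a) × Feasible I S × Covers c S
  class c = assess (computes-classUnion L c F F-computed (λ e → K (scaleOf e)) (λ e σ r≡e → trans
    (cong (λ b → + ⌊log₂ ℤ.∣ b ∣ ⌋ - rem (+ ⌊log₂ ℤ.∣ b ∣ ⌋ ℤ.+ + c) (+ L))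
      (trans (cong (read (λ j → + u j)) r≡e) (read-toℕ (λ j → + u j) e)))
    (scale≡ ⌊log₂ u e ⌋ c)))
    where
    open Class I l q c using (K; module Union)
    scaleOf : Fin m → ℕ
    scaleOf e = (⌊log₂ u e ⌋ + c) / L
    group-subset : ∀ t → F (K t) ⊆ group I (K t) ℓ
    group-subset t = proj₁ (F-approximative (K t))
    group-slack : ∀ t e → Nonempty (T[_] I e ∩ group I (K t) ℓ) →
                  fromℕ (load I (F (K t)) e) ℚ.≤ fromℕ (u e) ℚ.- 2^ (+ 1 - + q) ℚ.* 2^ K t
    group-slack t = proj₂ (proj₂ (F-approximative (K t)))
    assess : ∃[ S ] Computes (classUnion L A c) 0ℤ S (unionCost m n a) ×
               (∀ i → i ∈ S → ∃[ e ] i ∈ F (K (scaleOf e))) × (∀ e → F (K (scaleOf e)) ⊆ S) →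
             ∃[ S ] Computes (classUnion L A c) 0ℤ S (unionCost m n a) × Feasible I S × Covers c S
    assess (S , computed , S⊆F , F⊆S) = S , computed , U.feasible , covers
      where
      from : ∀ {i} → i ∈ S → ∃[ t ] i ∈ F (K t)
      from {i} i∈S = let e , i∈F = S⊆F i i∈S in scaleOf e , i∈F
      module U = Union (λ t → F (K t)) group-subset group-slack S from F⊆S
      covers : Covers c S
      covers r Ur O feasible = U.Profit.class-profit r {{upper-nonNeg {α} α>0 Ur}}
        (λ t O opt → proj₁ (proj₂ (F-approximative (K t))) O opt r Ur) O feasible

  Solution : ℕ → Subset n → Set
  Solution c S = Feasible I S × (∀ c′ → c′ ≤ c → Covers c′ S)

  covers-≤ : ∀ c {S S′} → profit I S ≤ profit I S′ → Covers c S → Covers c S′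
  covers-≤ c {S} {S′} S≤S′ covers r Ur O feasible =
    ratio-mono r {{upper-nonNeg {α} α>0 Ur}} {o} {o} {profit I S′} {profit I S} ≤-refl S≤S′ (covers r Ur O feasible)
    where
    o : ℕ
    o = profit I (O ∩ residueClass L ℓ lb c)

  Within : ℕ → Com X → (Subset n → Set) → Set
  Within b P Φ = ∃[ S ] Computes P 0ℤ S b × Φ S

  class-within : ∀ c → Within (69 * (m * a)) (classUnion L A c) (λ S → Feasible I S × Covers c S)
  class-within c = let S , (t , outputs , t≤) , good = class c in
    S , (t , outputs , λ h → ≤-trans (t≤ h) (unionCost≤ (m>0 h) (n>0 h) (n≤a h))) , good

  better-within : ∀ {P Q} c k → Within (k * (m * a)) P (Solution c) →
                  Within (69 * (m * a)) Q (λ S → Feasible I S × Covers (suc c) S) →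
                  Within ((k + 69 + 51) * (m * a)) (better P Q) (Solution (suc c))
  better-within {P} {Q} c k (R , R-computed , R-feasible , R-covers) (T , T-computed , T-feasible , T-covers) =
    finish (computes-better {P} {Q} {R} {T} R-computed T-computed)
    where
    feasible : ∀ {S} → S ≡ R ⊎ S ≡ T → Feasible I S
    feasible (inj₁ refl) = R-feasible
    feasible (inj₂ refl) = T-feasible
    covers : ∀ {S} → profit I R ≤ profit I S → profit I T ≤ profit I S →
             ∀ c′ → c′ < suc c ⊎ c′ ≡ suc c → Covers c′ S
    covers {S} R≤S _ c′ (inj₁ (s≤s c′≤c)) = covers-≤ c′ {R} {S} R≤S (R-covers c′ c′≤c)
    covers {S} _ T≤S c′ (inj₂ refl) = covers-≤ (suc c) {T} {S} T≤S T-covers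
    finish : ∃[ S ] Computes (better P Q) 0ℤ S (betterCost n (k * (m * a)) (69 * (m * a))) ×
               (S ≡ R ⊎ S ≡ T) × profit I R ≤ profit I S × profit I T ≤ profit I S →
             Within ((k + 69 + 51) * (m * a)) (better P Q) (Solution (suc c))
    finish (S , (t , outputs , t≤) , choice , R≤S , T≤S) =
      S , (t , outputs , λ h → ≤-trans (t≤ h) (betterCost≤ (m>0 h) (n>0 h) (n≤a h) k 69 ≤-refl ≤-refl)) ,
      feasible {S} choice , λ c′ c′≤ → covers {S} R≤S T≤S c′ (m≤n⇒m<n∨m≡n c′≤)

  best-within : ∀ c → Within (κ c * (m * a)) (best (classUnion L A) c) (Solution c)
  best-within zero = let S , computed , feasible , covers = class-within 0 in
    S , computed , feasible , λ { zero _ → covers }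
  best-within (suc c) = better-within c (κ c) (best-within c) (class-within (suc c))

  -- Adding the L classes gives ℓ w(O) on the left, as every task is counted ℓ times, and L w(S) on
  -- the right. `Ur` says that (ℓ / L) r lies above α, and this is the factor used in each class.
  solution⇒approx : ∀ {S} → Solution (l + q) S → ApproxSolution I (scaled ℓ q α) S
  solution⇒approx {S} (feasible , covers) = feasible , λ O (_ , O-feasible , _) r Ur →
    ratio-unscale ℓ L {{_}} {{c≢0}} r (profit I O) (profit I S)
      (subst (λ x → fromℕ x ℚ.≤ (c⁻¹ ℚ.* r) ℚ.* fromℕ (L * profit I S))
        (∑-residueClasses L (m≤m+n ℓ q) lb O w)
        (ratio-sum (c⁻¹ ℚ.* r) {{upper-nonNeg {α} α>0 Ur}} L (λ c → profit I (O ∩ residueClass L ℓ lb c)) (profit I S)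
          (λ c c<L → covers c (s≤s⁻¹ c<L) (c⁻¹ ℚ.* r) Ur O O-feasible)))
    where
    c≢0 : ℚ.NonZero (+ L ℚ./ ℓ)
    c≢0 = ℚₚ.pos⇒nonZero (+ L ℚ./ ℓ) {{ℚₚ.normalize-pos L ℓ}}
    c⁻¹ : ℚ
    c⁻¹ = (1/ (+ L ℚ./ ℓ)) {{c≢0}}

lemma3p2 : (X : Extension) (𝓘 : Instance → Set)
    (ℓ q : ℕ) .{{_ : NonZero ℓ}} .{{_ : NonZero q}}
    (α : ℝ) → Positiveᴿ α →
    (p : List ℕ) (A : Com X) →
    GroupApproxAlg 𝓘 α (2^ (+ 1 - + q)) ℓ (λ I → poly p (Instance.n I)) A →
    ∃[ P ] ApproxAlg {X} 𝓘 (scaled ℓ q α) (λ I → Instance.m I * poly p (Instance.n I)) P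
lemma3p2 X 𝓘 (suc l) q α α>0 p A (C , N , solve) =
  -- The indices 0 to l + q are all L = suc (l + q) residues. The threshold `suc N` ensures n > 0,
  -- hence m > 0, for the cost estimates.
  best (classUnion (suc l + q) A) (l + q) , κ (l + q) * C , suc N , approximate
  where
  rearrange : ∀ k m C x → k * (m * (C * x)) ≡ k * C * (m * x)
  rearrange = ℕ-Solver.solve-∀
  approximate : ∀ I → 𝓘 I → ∃[ F ] ∃[ c ]
    Outputs (best (classUnion (suc l + q) A) (l + q)) I 0ℤ F c ×
    ApproxSolution I (scaled (suc l) q α) F ×
    (suc N ≤ Instance.n I → c ≤ κ (l + q) * C * (Instance.m I * poly p (Instance.n I)))
  approximate I I∈𝓘 = conclude (S.best-within (l + q))
    where
    open Instance I
    solve′ : ∀ k → ∃[ F ] ∃[ c ] Outputs A I k F c ×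
      Approximative I α (2^ (+ 1 - + q)) k (suc l) F × (suc N ≤ n → c ≤ C * poly p n)
    solve′ k =
      let F , c , outputs , approximative , c≤ = solve I I∈𝓘 k
      in F , c , outputs , approximative , λ N<n → c≤ (<⇒≤ N<n)
    module S = Combine l q α α>0 A I (suc N ≤ n) (C * poly p n) (≤-trans (s≤s z≤n)) solve′
    conclude : S.Within (κ (l + q) * (m * (C * poly p n))) (best (classUnion (suc l + q) A) (l + q)) (S.Solution (l + q)) → _
    conclude (F , (c , outputs , c≤) , solution) =
      F , c , outputs , S.solution⇒approx {F} solution ,
      λ N<n → ≤-trans (c≤ N<n) (≤-reflexive (rearrange (κ (l + q)) m C (poly p n)))
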